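{- There exist constants $c>0$ and $n_0$ such that for every positive integer $n\equiv 0\pmod 4$ and every positive integer $p$, if $n\geq n_0$ and $n-4p\geq c\log^2 n$, then there exists a globally simple Heffter array $H(n;4p+3)$.
   Context: A Heffter array $H(n;k)$ is an $n\times n$ array of integers (some cells may be empty) such that: each row and each column contains exactly $k$ filled cells; the entries in every row and every column sum to $0$ modulo $2nk+1$; and for each integer $1\leq x\leq nk$, either $x$ or $-x$ appears in the array. Rows and columns are indexed by $0,1,\dots,n-1$. The natural ordering of a row lists its filled cells from left to right (increasing column index), and that of a column from top to bottom (increasing row index). The array is globally simple if, for every row and every column, writing its entries in natural order as $a_0,\dots,a_{k-1}$, the partial sums $\sum_{j=0}^{i}a_j$, $i=0,\dots,k-1$, are pairwise distinct modulo $2nk+1$. -}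

module Defs where

open import Data.Nat as ℕ using (ℕ; _≤_)
open import Data.Integer as ℤ using (ℤ; +_; _-_; -_)
open import Data.Integer.Divisibility as ℤD using ()
open import Data.Fin using (Fin)
open import Data.Maybe using (Maybe; just)
open import Data.List using (List; []; _∷_; catMaybes; foldr; length; allFin; map)
open import Data.List.Relation.Unary.AllPairs using (AllPairs)
open import Data.Vec.Functional using (Vector)
open import Data.Product using (∃₂; _×_)
open import Data.Sum using (_⊎_)
open import Relation.Binary.PropositionalEquality using (_≡_)
open import Relation.Nullary using (¬_)

_≡_[mod_] : ℤ → ℤ → ℕ → Set
a ≡ b [mod m ] = (+ m) ℤD.∣ (a - b)

Array : ℕ → Set
Array n = Fin n → Fin n → Maybe ℤ

allFinList : (n : ℕ) → List (Fin n)
allFinList n = allFin n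

rowEntries : {n : ℕ} → Array n → Fin n → List ℤ
rowEntries {n} A i = catMaybes (map (λ j → A i j) (allFinList n))

colEntries : {n : ℕ} → Array n → Fin n → List ℤ
colEntries {n} A j = catMaybes (map (λ i → A i j) (allFinList n))

zsum : List ℤ → ℤ
zsum = foldr ℤ._+_ (+ 0)

partialSums : List ℤ → List ℤ
partialSums = go (+ 0)
  where
  go : ℤ → List ℤ → List ℤ
  go s [] = []
  go s (x ∷ xs) = (s ℤ.+ x) ∷ go (s ℤ.+ x) xs

GoodLine : ℕ → ℕ → List ℤ → Set
GoodLine k v xs = (length xs ≡ k) × (zsum xs ≡ + 0 [mod v ])

IsHeffter : (n k : ℕ) → Array n → Set
IsHeffter n k A =
  ((i : Fin n) → GoodLine k v (rowEntries A i)) ×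
  ((j : Fin n) → GoodLine k v (colEntries A j)) ×
  ((x : ℕ) → 1 ≤ x → x ≤ n ℕ.* k →
     ∃₂ λ i j → (A i j ≡ just (+ x)) ⊎ (A i j ≡ just (- (+ x))))
  where
  v = 2 ℕ.* n ℕ.* k ℕ.+ 1

SimpleLine : ℕ → List ℤ → Set
SimpleLine v xs = AllPairs (λ a b → ¬ (a ≡ b [mod v ])) (partialSums xs)

IsGloballySimple : (n k : ℕ) → Array n → Set
IsGloballySimple n k A =
  ((i : Fin n) → SimpleLine v (rowEntries A i)) ×
  ((j : Fin n) → SimpleLine v (colEntries A j))
  where
  v = 2 ℕ.* n ℕ.* k ℕ.+ 1

{-# OPTIONS --safe #-}
-- Write n = 4m and cut the array into 2 × 2 blocks, arranged along antidiagonals of blocks so that rows and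
-- columns play the same role. Three antidiagonals carry a 3-part: m copies of a 4 × 4 pattern with three entries
-- per row and column, whose absolute values fill 1, …, 12m. Each of the next 2p antidiagonals is filled with the
-- next 8m values, by blocks with entries x + d + e, −(x + e) in the top and −(x + d), x in the bottom row, negated
-- on the last p antidiagonals; such a block adds ±d to the sum of a row and ±e to the sum of a column.
--
-- Up to a global sign, the sums of a row over whole pairs of entries are 0, 1, …, p − 1, then, after a jump by m,
-- m + p − 1, …, m, and finally 3m after a jump by 2m; for a column they are 0, 2, …, 2(p − 1), then
-- 4m + 2(p − 1), …, 4m, and finally 3m. The 3-part contributes −3m and closes the line, while its two
-- intermediate sums avoid the values above. The sums in the middle of a pair increase and exceed 12m in the first
-- half, and decrease below −12m in the second half. So the partial sums are distinct integers in an interval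
-- shorter than 2nk + 1. As the total is 0, the place where a line is cut open does not matter.
module Submission where

open import Defs
open import Data.Nat using (ℕ; _≤_; _*_; _+_; _^_; _%_)
open import Data.Nat.Logarithm using (⌈log₂_⌉)
open import Data.Product using (Σ; ∃; _×_)
open import Relation.Binary.PropositionalEquality using (_≡_)

import Algebra.Properties.AbelianGroup
open import Data.Bool using (Bool; true; false; not; if_then_else_; T; _xor_)
open import Data.Bool.Properties using (not-involutive)
open import Data.Empty using (⊥-elim)
open import Data.Fin using (Fin; toℕ; fromℕ<)
open import Data.Fin.Properties using (toℕ<n; toℕ-fromℕ<)
open import Data.Integer as ℤ using (ℤ; +_; -_; 0ℤ; ∣_∣; +≤+; +<+)
import Data.Integer.Properties as ℤ
import Data.Integer.Tactic.RingSolver as ℤS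
open import Data.List using (List; []; _∷_; _++_; map; length; applyUpTo; concat; catMaybes; allFin; tabulate)
open import Data.List.Properties
  using (length-++; ++-identityʳ; ++-assoc; length-map; map-id; map-++; map-tabulate; map-applyUpTo; concat-map; concat-++; catMaybes-++)
open import Data.List.Relation.Unary.All as All using (All; []; _∷_)
import Data.List.Relation.Unary.All.Properties as All
open import Data.List.Relation.Unary.AllPairs as AllPairs using (AllPairs; []; _∷_)
import Data.List.Relation.Unary.AllPairs.Properties as AllPairs
open import Data.Maybe as Maybe using (Maybe; just; nothing)
open import Data.Nat as ℕ using (zero; suc; _<_; _∸_; s≤s; z≤n; NonZero; ⌊_/2⌋; _≡ᵇ_; _/_)
import Data.Nat.Divisibility as ℕ
open import Data.Nat.DivMod using (m%n<n; m<n⇒m%n≡m; m≡m%n+[m/n]*n; [m+kn]%n≡m%n; [m+n]%n≡m%n; m<n*o⇒m/o<n)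
open import Data.Nat.Logarithm using (⌈log₂⌉-mono-≤; ⌈log₂2^n⌉≡n)
import Data.Nat.Properties as ℕ
import Data.Nat.Tactic.RingSolver as ℕS
open import Data.Product using (_,_; ∃₂; proj₁; proj₂)
open import Data.Sum as Sum using (_⊎_; inj₁; inj₂)
open import Function using (_∘_; id)
open import Relation.Binary.PropositionalEquality hiding (J)
open import Relation.Nullary using (¬_; yes; no)
open import Relation.Nullary.Decidable using (Dec; _×-dec_; _⊎-dec_; True; toWitness)

private
  module ℤ+ = Algebra.Properties.AbelianGroup ℤ.+-0-abelianGroup

-- Lines of an array and their partial sums

Incongruent : ℕ → ℤ → ℤ → Set
Incongruent v a b = ¬ (a ≡ b [mod v ])

zsum-++ : ∀ xs ys → zsum (xs ++ ys) ≡ zsum xs ℤ.+ zsum ys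
zsum-++ []       ys = sym (ℤ.+-identityˡ _)
zsum-++ (x ∷ xs) ys = trans (cong (ℤ._+_ x) (zsum-++ xs ys)) (sym (ℤ.+-assoc x _ _))

zsum-neg : ∀ xs → zsum (map -_ xs) ≡ - zsum xs
zsum-neg []       = refl
zsum-neg (x ∷ xs) = trans (cong (ℤ._+_ (- x)) (zsum-neg xs)) (sym (ℤ.neg-distrib-+ x (zsum xs)))

-- The sums of the proper prefixes of xs, the empty one included, starting from s.
prefixSums : ℤ → List ℤ → List ℤ
prefixSums s []       = []
prefixSums s (x ∷ xs) = s ∷ prefixSums (s ℤ.+ x) xs

prefixSums-++ : ∀ s xs ys → prefixSums s (xs ++ ys) ≡ prefixSums s xs ++ prefixSums (s ℤ.+ zsum xs) ys
prefixSums-++ s []       ys = cong (λ t → prefixSums t ys) (sym (ℤ.+-identityʳ s))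
prefixSums-++ s (x ∷ xs) ys = cong (s ∷_) (trans (prefixSums-++ (s ℤ.+ x) xs ys)
  (cong (λ t → prefixSums (s ℤ.+ x) xs ++ prefixSums t ys) (ℤ.+-assoc s x (zsum xs))))

prefixSums-shift : ∀ t s xs → prefixSums (t ℤ.+ s) xs ≡ map (ℤ._+_ t) (prefixSums s xs)
prefixSums-shift t s []       = refl
prefixSums-shift t s (x ∷ xs) = cong (t ℤ.+ s ∷_)
  (trans (cong (λ u → prefixSums u xs) (ℤ.+-assoc t s x)) (prefixSums-shift t (s ℤ.+ x) xs))

prefixSums-neg : ∀ s xs → prefixSums (- s) (map -_ xs) ≡ map -_ (prefixSums s xs)
prefixSums-neg s []       = refl
prefixSums-neg s (x ∷ xs) = cong (- s ∷_)
  (trans (cong (λ u → prefixSums u (map -_ xs)) (sym (ℤ.neg-distrib-+ s x))) (prefixSums-neg (s ℤ.+ x) xs))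

-- The recursion inside `partialSums` is local to it, so the first entry `s` plays the part of its
-- accumulator and makes the induction possible.
partialSums-tail : ∀ s xs → partialSums (s ∷ xs) ++ [] ≡ prefixSums s xs ++ (s ℤ.+ zsum xs) ∷ []
partialSums-tail s []       = cong (_∷ []) (ℤ.+-comm 0ℤ s)
partialSums-tail s (x ∷ xs) with h ← partialSums-tail (s ℤ.+ x) xs
  rewrite ℤ.+-identityˡ (s ℤ.+ x) | ℤ.+-identityˡ s = cong (s ∷_) (trans h
    (cong (λ u → prefixSums (s ℤ.+ x) xs ++ u ∷ []) (ℤ.+-assoc s x (zsum xs))))

module _ {v : ℕ} where

  incongruent-sym : ∀ {a b} → Incongruent v a b → Incongruent v b a
  incongruent-sym {a} {b} a≢b b≡a = a≢b (subst (v ℕ.∣_) (ℤ.∣i-j∣≡∣j-i∣ b a) b≡a)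

  incongruent-unshift : ∀ t {a b} → Incongruent v (t ℤ.+ a) (t ℤ.+ b) → Incongruent v a b
  incongruent-unshift t {a} {b} a≢b p = a≢b (subst (λ u → v ℕ.∣ ∣ u ∣) (cancel t a b) p)
    where
    cancel : ∀ t a b → a ℤ.- b ≡ (t ℤ.+ a) ℤ.- (t ℤ.+ b)
    cancel = ℤS.solve-∀

  incongruent-neg : ∀ {a b} → Incongruent v a b → Incongruent v (- a) (- b)
  incongruent-neg {a} {b} a≢b p = a≢b (subst (v ℕ.∣_)
    (trans (cong ∣_∣ (sym (ℤ.neg-distrib-+ a (- b)))) (ℤ.∣-i∣≡∣i∣ (a ℤ.- b))) p)

  -- Incongruence is symmetric, so the order of the list is immaterial: the entries of `xs` move to
  -- the end one at a time.
  AllPairs-swap : ∀ xs ys → AllPairs (Incongruent v) (xs ++ ys) → AllPairs (Incongruent v) (ys ++ xs)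
  AllPairs-swap []       ys p = subst (AllPairs _) (sym (++-identityʳ ys)) p
  AllPairs-swap (x ∷ xs) ys (px ∷ p) = subst (AllPairs _) (++-assoc ys (x ∷ []) xs)
    (AllPairs-swap xs (ys ++ x ∷ []) (subst (AllPairs _) (++-assoc xs ys (x ∷ []))
      (AllPairs.++⁺ p ([] ∷ []) (All.map (λ {y} q → incongruent-sym {x} {y} q ∷ []) px))))

-- With total 0 over the integers, rotation merely translates the prefix sums. Counting the empty
-- prefix in place of the whole line changes nothing, since both have sum 0.
record Line (v k : ℕ) (xs : List ℤ) : Set where
  constructor line
  field
    length≡  : length xs ≡ k
    sum≡0    : zsum xs ≡ 0ℤ
    distinct : AllPairs (Incongruent v) (prefixSums 0ℤ xs)

open Line public

module _ {v k : ℕ} where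

  Line-neg : ∀ {xs} → Line v k xs → Line v k (map -_ xs)
  Line-neg {xs} l = line (trans (length-map -_ xs) (length≡ l))
    (trans (zsum-neg xs) (cong -_ (sum≡0 l)))
    (subst (AllPairs _) (sym (prefixSums-neg 0ℤ xs)) (AllPairs.map⁺ (AllPairs.map (λ {a} {b} → incongruent-neg {v} {a} {b}) (distinct l))))

  -- Because the total is 0, translating the prefix sums of `ys ++ xs` by the sum of `xs` gives
  -- those of `xs ++ ys` with the two halves exchanged.
  Line-rotate : ∀ xs ys → Line v k (xs ++ ys) → Line v k (ys ++ xs)
  Line-rotate xs ys l = line
    (trans (length-++ ys) (trans (ℕ.+-comm (length ys) _) (trans (sym (length-++ xs)) (length≡ l))))
    (trans (zsum-++ ys xs) sum-swap)
    (subst (AllPairs _) (sym (prefixSums-++ 0ℤ ys xs))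
      (AllPairs.map (λ {a} {b} → incongruent-unshift t {a} {b}) (AllPairs.map⁻ (subst (AllPairs _) eq
        (AllPairs-swap (prefixSums 0ℤ xs) (prefixSums (0ℤ ℤ.+ zsum xs) ys)
          (subst (AllPairs _) (prefixSums-++ 0ℤ xs ys) (distinct l)))))))
    where
    t = zsum xs
    sum-swap : zsum ys ℤ.+ zsum xs ≡ 0ℤ
    sum-swap = trans (ℤ.+-comm (zsum ys) _) (trans (sym (zsum-++ xs ys)) (sum≡0 l))
    open ≡-Reasoning
    eq : prefixSums (0ℤ ℤ.+ zsum xs) ys ++ prefixSums 0ℤ xs ≡
         map (ℤ._+_ t) (prefixSums 0ℤ ys ++ prefixSums (0ℤ ℤ.+ zsum ys) xs)
    eq = begin
      prefixSums (0ℤ ℤ.+ t) ys ++ prefixSums 0ℤ xs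
        ≡⟨ cong₂ (λ a b → prefixSums a ys ++ prefixSums b xs) (ℤ.+-comm 0ℤ t)
             (trans (sym sum-swap) (trans (ℤ.+-comm (zsum ys) t) (cong (ℤ._+_ t) (sym (ℤ.+-identityˡ _))))) ⟩
      prefixSums (t ℤ.+ 0ℤ) ys ++ prefixSums (t ℤ.+ (0ℤ ℤ.+ zsum ys)) xs
        ≡⟨ prefixSums-++′ ⟩
      prefixSums (t ℤ.+ 0ℤ) (ys ++ xs)
        ≡⟨ prefixSums-shift t 0ℤ (ys ++ xs) ⟩
      map (ℤ._+_ t) (prefixSums 0ℤ (ys ++ xs))
        ≡⟨ cong (map (ℤ._+_ t)) (prefixSums-++ 0ℤ ys xs) ⟩
      map (ℤ._+_ t) (prefixSums 0ℤ ys ++ prefixSums (0ℤ ℤ.+ zsum ys) xs) ∎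
      where
      prefixSums-++′ = trans (cong (λ u → prefixSums (t ℤ.+ 0ℤ) ys ++ prefixSums u xs) (sym (ℤ.+-assoc t 0ℤ (zsum ys))))
        (sym (prefixSums-++ (t ℤ.+ 0ℤ) ys xs))

  Line⇒GoodLine : ∀ {xs} → Line v k xs → GoodLine k v xs
  Line⇒GoodLine l = length≡ l , subst (λ s → s ≡ 0ℤ [mod v ]) (sym (sum≡0 l)) (v ℕ.∣0)

  -- `SimpleLine` omits the empty prefix and includes the whole line. As the total is 0, moving the
  -- leading 0 to the end turns one list of sums into the other.
  Line⇒SimpleLine : ∀ {xs} → Line v k xs → SimpleLine v xs
  Line⇒SimpleLine {[]}     l = []
  Line⇒SimpleLine {x ∷ xs} l = subst (AllPairs _) (sym eq)
      (AllPairs-swap (0ℤ ∷ []) (prefixSums (0ℤ ℤ.+ x) xs) (distinct l))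
    where
    eq : partialSums (x ∷ xs) ≡ prefixSums (0ℤ ℤ.+ x) xs ++ 0ℤ ∷ []
    eq = trans (sym (++-identityʳ _)) (trans (partialSums-tail x xs)
      (cong₂ (λ a b → prefixSums a xs ++ b ∷ []) (sym (ℤ.+-identityˡ x)) (sum≡0 l)))

-- Lines as cyclic sequences of blocks

module _ {A : Set} where

  applyUpTo-cong : ∀ {f g : ℕ → A} n → (∀ i → i < n → f i ≡ g i) → applyUpTo f n ≡ applyUpTo g n
  applyUpTo-cong zero    h = refl
  applyUpTo-cong (suc n) h = cong₂ _∷_ (h 0 ℕ.z<s) (applyUpTo-cong n (λ i i<n → h (suc i) (ℕ.s<s i<n)))

  applyUpTo-+ : ∀ (f : ℕ → A) m n → applyUpTo f (m + n) ≡ applyUpTo f m ++ applyUpTo (λ i → f (m + i)) n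
  applyUpTo-+ f zero    n = refl
  applyUpTo-+ f (suc m) n = cong (f 0 ∷_) (applyUpTo-+ (f ∘ suc) m n)

  tabulate-toℕ : ∀ (f : ℕ → A) n → tabulate {n = n} (λ i → f (toℕ i)) ≡ applyUpTo f n
  tabulate-toℕ f zero    = refl
  tabulate-toℕ f (suc n) = cong (f 0 ∷_) (tabulate-toℕ (f ∘ suc) n)

-- Groups a line by blocks: it crosses each 2 × 2 block in two consecutive cells.
catMaybes-pairs : ∀ {A : Set} (f : ℕ → Maybe A) N → catMaybes (map (λ i → f (toℕ i)) (allFin (N * 2))) ≡
  concat (applyUpTo (λ J → catMaybes (f (J * 2) ∷ f (suc (J * 2)) ∷ [])) N)
catMaybes-pairs {A} f N = trans (cong catMaybes (trans (map-tabulate id (λ i → f (toℕ i))) (tabulate-toℕ f (N * 2)))) (go f N)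
  where
  go : ∀ (f : ℕ → Maybe A) N → catMaybes (applyUpTo f (N * 2)) ≡
    concat (applyUpTo (λ J → catMaybes (f (J * 2) ∷ f (suc (J * 2)) ∷ [])) N)
  go f zero    = refl
  go f (suc N) = trans (catMaybes-++ (f 0 ∷ f 1 ∷ []) (applyUpTo (f ∘ suc ∘ suc) (N * 2))) (cong (catMaybes (f 0 ∷ f 1 ∷ []) ++_) (go (f ∘ suc ∘ suc) N))

-- In natural order a line starts at antidiagonal `c % N` and wraps around once, so it is a rotation
-- of the line read from antidiagonal 0.
Line-cyclic : ∀ {v k} (f : ℕ → List ℤ) (c N : ℕ) .{{_ : NonZero N}} → Line v k (concat (applyUpTo f N)) →
  Line v k (concat (applyUpTo (λ J → f ((J + c) % N)) N))
Line-cyclic {v} {k} f c N l = subst (Line v k) (sym eq)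
    (Line-rotate (concat (applyUpTo f a)) (concat (applyUpTo (λ i → f (a + i)) r))
      (subst (Line v k) (trans (cong (λ n → concat (applyUpTo f n)) N≡a+r) (split f a r)) l))
  where
  a = c % N
  r = N ∸ a
  a<N : a < N
  a<N = m%n<n c N
  N≡a+r : N ≡ a + r
  N≡a+r = sym (ℕ.m+[n∸m]≡n (ℕ.<⇒≤ a<N))
  split : ∀ (f : ℕ → List ℤ) a r → concat (applyUpTo f (a + r)) ≡ concat (applyUpTo f a) ++ concat (applyUpTo (λ i → f (a + i)) r)
  split f a r = trans (cong concat (applyUpTo-+ f a r)) (sym (concat-++ (applyUpTo f a) _))
  reduce : ∀ J → (J + c) % N ≡ (J + a) % N
  reduce J = trans (cong (λ u → (J + u) % N) (m≡m%n+[m/n]*n c N))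
    (trans (cong (_% N) (sym (ℕ.+-assoc J a _))) ([m+kn]%n≡m%n (J + a) (c / N) N))
  before : ∀ J → J < r → (J + c) % N ≡ a + J
  before J J<r = trans (reduce J) (trans (cong (_% N) (ℕ.+-comm J a))
    (m<n⇒m%n≡m (subst (a + J <_) (sym N≡a+r) (ℕ.+-monoʳ-< a J<r))))
  after : ∀ J → J < a → (r + J + c) % N ≡ J
  after J J<a = trans (reduce (r + J)) (trans (cong (_% N) arith)
    (trans ([m+n]%n≡m%n J N) (m<n⇒m%n≡m (ℕ.<-trans J<a a<N))))
    where
    arith : r + J + a ≡ J + N
    arith = trans (cong (λ u → u + a) (ℕ.+-comm r J)) (trans (ℕ.+-assoc J r a)
      (cong (_+_ J) (ℕ.m∸n+n≡m (ℕ.<⇒≤ a<N))))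
  eq : concat (applyUpTo (λ J → f ((J + c) % N)) N) ≡ concat (applyUpTo (λ i → f (a + i)) r) ++ concat (applyUpTo f a)
  eq = trans (cong (λ n → concat (applyUpTo (λ J → f ((J + c) % N)) n)) (trans N≡a+r (ℕ.+-comm a r)))
    (trans (split (λ J → f ((J + c) % N)) r a)
      (cong₂ (λ xss yss → concat xss ++ concat yss)
        (applyUpTo-cong r (λ J J<r → cong f (before J J<r)))
        (applyUpTo-cong a (λ J J<a → cong f (after J J<a)))))

-- Lines made of three entries and a staircase

Within : ℕ → ℕ → ℤ → Set
Within L H a = - + L ℤ.≤ a × a ℤ.≤ + H

-- The difference is nonzero and at most `L + H` in absolute value, hence too small to be a multiple
-- of `v`.
within-incongruent : ∀ {v L H a b} → L + H < v → Within L H a → Within L H b → a ≢ b → Incongruent v a b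
within-incongruent {v} {L} {H} {a} {b} L+H<v wa wb a≢b v∣a-b =
  ℕ.>⇒∤ {{ℕ.≢-nonZero (λ e → a≢b (ℤ.i-j≡0⇒i≡j a b (ℤ.∣i∣≡0⇒i≡0 e)))}} (ℕ.≤-<-trans small L+H<v) v∣a-b
  where
  -- Translation by `L` makes both numbers natural; their distance is then at most the larger of the
  -- two.
  above : ∀ {a} → Within L H a → ∃ λ k → + L ℤ.+ a ≡ + k × k ≤ L + H
  above {a} (lo , hi) with + L ℤ.+ a in eq
  ... | + k = k , refl , ℤ.drop‿+≤+ (subst (λ s → s ℤ.≤ + (L + H)) eq (ℤ.+-monoʳ-≤ (+ L) hi))
  ... | ℤ.-[1+ k ] with subst₂ ℤ._≤_ (ℤ.+-inverseʳ (+ L)) eq (ℤ.+-monoʳ-≤ (+ L) lo)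
  ... | ()
  shift : ∀ l a b → a ℤ.- b ≡ (l ℤ.+ a) ℤ.- (l ℤ.+ b)
  shift = ℤS.solve-∀
  small : ∣ a ℤ.- b ∣ ≤ L + H
  small with j , ej , hj ← above {a} wa | k , ek , hk ← above {b} wb
    rewrite shift (+ L) a b | ej | ek | ℤ.m-n≡m⊖n j k = ℕ.≤-trans (ℤ.∣m⊝n∣≤m⊔n j k) (ℕ.⊔-lub hj hk)

-- `S i` is the sum reached before the group `w i`. The exit from the last group is not prescribed,
-- because there the walk will jump instead of making a regular step.
prefixSums-concat : ∀ (S : ℕ → ℤ) (w : ℕ → List ℤ) n → (∀ i → i < n → S (suc i) ≡ S i ℤ.+ zsum (w i)) →
  prefixSums (S 0) (concat (applyUpTo w (suc n))) ≡ concat (applyUpTo (λ i → prefixSums (S i) (w i)) (suc n)) ×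
  S 0 ℤ.+ zsum (concat (applyUpTo w (suc n))) ≡ S n ℤ.+ zsum (w n)
prefixSums-concat S w zero    h = trans (cong (prefixSums (S 0)) (++-identityʳ (w 0))) (sym (++-identityʳ _)) ,
  cong (λ xs → S 0 ℤ.+ zsum xs) (++-identityʳ (w 0))
prefixSums-concat S w (suc n) h =
  let ih₁ , ih₂ = prefixSums-concat (S ∘ suc) (w ∘ suc) n (λ i i<n → h (suc i) (ℕ.s<s i<n))
      rest = concat (applyUpTo (w ∘ suc) (suc n))
      next = sym (h 0 ℕ.z<s)
  in trans (prefixSums-++ (S 0) (w 0) rest)
       (cong (prefixSums (S 0) (w 0) ++_) (trans (cong (λ s → prefixSums s rest) next) ih₁)) ,
     trans (cong (ℤ._+_ (S 0)) (zsum-++ (w 0) rest))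
       (trans (sym (ℤ.+-assoc (S 0) (zsum (w 0)) (zsum rest))) (trans (cong (λ s → s ℤ.+ zsum rest) next) ih₂))

length-concat-pairs : ∀ {A : Set} (f g : ℕ → A) n → length (concat (applyUpTo (λ i → f i ∷ g i ∷ []) n)) ≡ n * 2
length-concat-pairs f g zero    = refl
length-concat-pairs f g (suc n) = cong (suc ∘ suc) (length-concat-pairs (f ∘ suc) (g ∘ suc) n)

module _ {A : Set} {f g : ℕ → A} where

  All-concat-pairs : ∀ {P : A → Set} n → (∀ {i} → i < n → P (f i)) → (∀ {i} → i < n → P (g i)) →
    All P (concat (applyUpTo (λ i → f i ∷ g i ∷ []) n))
  All-concat-pairs n hf hg = All.concat⁺ (All.applyUpTo⁺₁ _ n (λ i<n → hf i<n ∷ hg i<n ∷ []))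

  AllPairs-concat-pairs : ∀ {R : A → A → Set} n → (∀ {i} → i < n → R (f i) (g i)) →
    (∀ {i j} → i < j → j < n → R (f i) (f j)) → (∀ {i j} → i < n → j < n → R (f i) (g j)) →
    (∀ {i j} → i < n → j < n → R (g i) (f j)) → (∀ {i j} → i < j → j < n → R (g i) (g j)) →
    AllPairs R (concat (applyUpTo (λ i → f i ∷ g i ∷ []) n))
  AllPairs-concat-pairs n h ff fg gf gg = AllPairs.concat⁺
    (All.applyUpTo⁺₁ _ n (λ i<n → (h i<n ∷ []) ∷ [] ∷ []))
    (AllPairs.applyUpTo⁺₁ _ n (λ i<j j<n → let i<n = ℕ.<-trans i<j j<n in
      (ff i<j j<n ∷ fg i<n j<n ∷ []) ∷ (gf i<n j<n ∷ gg i<j j<n ∷ []) ∷ []))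

∸-step : ∀ {i n} → i < n → n ∸ i ≡ suc (n ∸ suc i)
∸-step {i} {suc n} (s≤s i≤n) = ℕ.+-∸-assoc 1 i≤n

-- The zone left to the two intermediate sums of the 3-part: sums over whole pairs will lie in [0,
-- `U`), and sums in the middle of a pair beyond ±12m.
Outside : ℕ → ℕ → ℤ → Set
Outside m U t = (- + (12 * m) ℤ.≤ t × t ℤ.< 0ℤ) ⊎ (+ U ℤ.≤ t × t ℤ.≤ + (12 * m))

record Triple (m R U : ℕ) (x y z : ℤ) : Set where
  field
    sum      : x ℤ.+ y ℤ.+ z ≡ - + R
    x≢0      : x ≢ 0ℤ
    y≢0      : y ≢ 0ℤ
    outside₁ : Outside m U (+ R ℤ.+ x)
    outside₂ : Outside m U (+ R ℤ.+ x ℤ.+ y)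

-- One line of the array, up to rotation and sign: the three entries of the 3-part, then p pairs a, −y
-- followed by p pairs −a′, y′.
module Walk (m p′ d D R U : ℕ) (x y z : ℤ) (a y₁ a′ y′ : ℕ → ℕ) where

  p = suc p′

  line₁ line₂ walk : List ℤ
  line₁ = concat (applyUpTo (λ i → + a i ∷ - + y₁ i ∷ []) p)
  line₂ = concat (applyUpTo (λ i → - + a′ i ∷ + y′ i ∷ []) p)
  walk  = (x ∷ y ∷ z ∷ []) ++ line₁ ++ line₂

  -- Rows have d = 1, D = m, U = 5m and columns d = 2, D = 4m, U = 6m, both with R = 3m. Here `d` is
  -- the regular step and `D` the jump after the first half; the last pair leads from `D` to `R`,
  -- where the 3-part begins.
  record Hypotheses : Set where
    field
      1≤d      : 1 ≤ d
      d*p′<D   : d * p′ < D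
      D+d*p′<U : D + d * p′ < U
      U≤6m     : U ≤ 6 * m
      R<U      : R < U
      d*p′<R   : d * p′ < R
      R∉D+     : R < D ⊎ D + d * p′ < R
      a-range  : ∀ i → i < p → 12 * m + 8 * m * i < a i × a i ≤ 12 * m + 8 * m * suc i
      a′-range : ∀ i → i < p → 12 * m + 8 * m * (p + i) < a′ i × a′ i ≤ 12 * m + 8 * m * suc (p + i)
      up       : ∀ i → i < p′ → a i ≡ y₁ i + d
      jump     : a p′ ≡ y₁ p′ + D
      down     : ∀ i → i < p′ → a′ i ≡ y′ i + d
      jump′    : a′ p′ + R ≡ D + y′ p′
      triple   : Triple m R U x y z

  module _ (hyp : Hypotheses) where
    open Hypotheses hyp
    open Triple triple

    -- The sums before the i-th pair of each half. The closed walk is started at `R`, so that the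
    -- 3-part comes first and `line₁` begins at 0.
    S₁ S₂ : ℕ → ℤ
    S₁ i = + (d * i)
    S₂ i = + (D + d * (p′ ∸ i))

    S₁-step : ∀ i → i < p′ → S₁ (suc i) ≡ S₁ i ℤ.+ (+ a i ℤ.+ (- + y₁ i ℤ.+ 0ℤ))
    S₁-step i i<p′ rewrite up i i<p′ | ℕ.*-suc d i = eq (+ d) (+ (d * i)) (+ y₁ i)
      where
      eq : ∀ d e y → d ℤ.+ e ≡ e ℤ.+ (y ℤ.+ d ℤ.+ (- y ℤ.+ 0ℤ))
      eq = ℤS.solve-∀

    S₁-jump : S₁ p′ ℤ.+ (+ a p′ ℤ.+ (- + y₁ p′ ℤ.+ 0ℤ)) ≡ S₂ 0
    S₁-jump rewrite jump = eq (+ D) (+ (d * p′)) (+ y₁ p′)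
      where
      eq : ∀ d e y → e ℤ.+ (y ℤ.+ d ℤ.+ (- y ℤ.+ 0ℤ)) ≡ d ℤ.+ e
      eq = ℤS.solve-∀

    S₂-step : ∀ i → i < p′ → S₂ (suc i) ≡ S₂ i ℤ.+ (- + a′ i ℤ.+ (+ y′ i ℤ.+ 0ℤ))
    S₂-step i i<p′ rewrite down i i<p′ | ∸-step i<p′ | ℕ.*-suc d (p′ ∸ suc i) =
      eq (+ d) (+ D) (+ (d * (p′ ∸ suc i))) (+ y′ i)
      where
      eq : ∀ d D e y → D ℤ.+ e ≡ D ℤ.+ (d ℤ.+ e) ℤ.+ (- (y ℤ.+ d) ℤ.+ (y ℤ.+ 0ℤ))
      eq = ℤS.solve-∀

    S₂-jump : S₂ p′ ℤ.+ (- + a′ p′ ℤ.+ (+ y′ p′ ℤ.+ 0ℤ)) ≡ + R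
    S₂-jump rewrite ℕ.n∸n≡0 p′ | ℕ.*-zeroʳ d | ℕ.+-identityʳ D = eq (+ D) (+ a′ p′) (+ y′ p′) (+ R) (cong +_ jump′)
      where
      shuffle : ∀ D a y → D ℤ.+ (- a ℤ.+ (y ℤ.+ 0ℤ)) ≡ (D ℤ.+ y) ℤ.- a
      shuffle = ℤS.solve-∀
      cancel : ∀ a R → (a ℤ.+ R) ℤ.- a ≡ R
      cancel = ℤS.solve-∀
      eq : ∀ D a y R → a ℤ.+ R ≡ D ℤ.+ y → D ℤ.+ (- a ℤ.+ (y ℤ.+ 0ℤ)) ≡ R
      eq D a y R h = trans (shuffle D a y) (trans (cong (λ t → t ℤ.- a) (sym h)) (cancel a R))

    -- The sum before a pair and the sum in its middle. The first entry of a pair is positive in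
    -- `line₁` and negative in `line₂`.
    peak : ℕ → List ℤ
    peak i = S₁ i ∷ S₁ i ℤ.+ + a i ∷ []
    valley : ℕ → List ℤ
    valley i = S₂ i ∷ S₂ i ℤ.+ - + a′ i ∷ []

    3-part : List ℤ
    3-part = + R ∷ + R ℤ.+ x ∷ + R ℤ.+ x ℤ.+ y ∷ []

    3-part-sum : + R ℤ.+ x ℤ.+ y ℤ.+ z ≡ S₁ 0
    3-part-sum = trans (regroup (+ R) x y z) (trans (cong (ℤ._+_ (+ R)) sum)
      (trans (ℤ.+-inverseʳ (+ R)) (cong +_ (sym (ℕ.*-zeroʳ d)))))
      where
      regroup : ∀ R x y z → R ℤ.+ x ℤ.+ y ℤ.+ z ≡ R ℤ.+ (x ℤ.+ y ℤ.+ z)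
      regroup = ℤS.solve-∀

    line₁-sums = prefixSums-concat S₁ (λ i → + a i ∷ - + y₁ i ∷ []) p′ S₁-step
    line₂-sums = prefixSums-concat S₂ (λ i → - + a′ i ∷ + y′ i ∷ []) p′ S₂-step

    S₁+line₁ : S₁ 0 ℤ.+ zsum line₁ ≡ S₂ 0
    S₁+line₁ = trans (proj₂ line₁-sums) S₁-jump

    S₂+line₂ : S₂ 0 ℤ.+ zsum line₂ ≡ + R
    S₂+line₂ = trans (proj₂ line₂-sums) S₂-jump

    prefixSums-walk : prefixSums (+ R) walk ≡ 3-part ++ concat (applyUpTo peak p) ++ concat (applyUpTo valley p)
    prefixSums-walk = cong (λ ts → + R ∷ + R ℤ.+ x ∷ + R ℤ.+ x ℤ.+ y ∷ ts)
      (trans (cong (λ s → prefixSums s (line₁ ++ line₂)) 3-part-sum)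
        (trans (prefixSums-++ (S₁ 0) line₁ line₂)
          (cong₂ _++_ (proj₁ line₁-sums)
            (trans (cong (λ s → prefixSums s line₂) S₁+line₁) (proj₁ line₂-sums)))))

    walk-sum : zsum walk ≡ 0ℤ
    walk-sum = ℤ+.identityʳ-unique (+ R) (zsum walk) (trans
      (trans (cong (λ t → + R ℤ.+ (x ℤ.+ (y ℤ.+ (z ℤ.+ t)))) (zsum-++ line₁ line₂))
        (trans (regroup (+ R) x y z (zsum line₁) (zsum line₂))
          (cong (λ s → s ℤ.+ zsum line₁ ℤ.+ zsum line₂) 3-part-sum)))
      (trans (cong (λ s → s ℤ.+ zsum line₂) S₁+line₁) S₂+line₂))
      where
      regroup : ∀ R x y z s t → R ℤ.+ (x ℤ.+ (y ℤ.+ (z ℤ.+ (s ℤ.+ t)))) ≡ R ℤ.+ x ℤ.+ y ℤ.+ z ℤ.+ s ℤ.+ t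
      regroup = ℤS.solve-∀

    walk-length : length walk ≡ 4 * p + 3
    walk-length = trans (cong (λ l → 3 + l) (trans (length-++ line₁)
      (cong₂ _+_ (length-concat-pairs (λ i → + a i) (λ i → - + y₁ i) p)
        (length-concat-pairs (λ i → - + a′ i) (λ i → + y′ i) p)))) (eq p)
      where
      eq : ∀ p → 3 + (p * 2 + p * 2) ≡ 4 * p + 3
      eq = ℕS.solve-∀

    Low High Small : ℤ → Set
    Low t   = t ℤ.< - + (12 * m)
    High t  = + (12 * m) ℤ.< t
    Small t = + 0 ℤ.≤ t × t ℤ.< + U

    U≤12m : U ≤ 12 * m
    U≤12m = ℕ.≤-trans U≤6m (ℕ.*-monoˡ-≤ m (ℕ.m≤m+n 6 6))

    -12m≤0 : - + (12 * m) ℤ.≤ 0ℤ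
    -12m≤0 = ℤ.neg-mono-≤ (+≤+ z≤n)

    low<small : ∀ {s t} → Low s → Small t → s ℤ.< t
    low<small l (0≤t , _) = ℤ.<-≤-trans l (ℤ.≤-trans -12m≤0 0≤t)

    small<high : ∀ {s t} → Small s → High t → s ℤ.< t
    small<high (_ , s<U) h = ℤ.<-trans (ℤ.<-≤-trans s<U (+≤+ U≤12m)) h

    low<high : ∀ {s t} → Low s → High t → s ℤ.< t
    low<high l h = ℤ.<-trans (ℤ.<-≤-trans l (ℤ.≤-trans -12m≤0 (+≤+ z≤n))) h

    low≢outside : ∀ {s t} → Outside m U t → Low s → t ≢ s
    low≢outside (inj₁ (lo , _)) l refl = ℤ.<-irrefl refl (ℤ.<-≤-trans l lo)
    low≢outside (inj₂ (U≤t , _)) l refl = ℤ.<-irrefl refl (ℤ.<-≤-trans l (ℤ.≤-trans -12m≤0 (ℤ.≤-trans (+≤+ z≤n) U≤t)))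

    high≢outside : ∀ {s t} → Outside m U t → High s → t ≢ s
    high≢outside (inj₁ (_ , t<0)) h refl = ℤ.<-irrefl refl (ℤ.<-trans (ℤ.≤-<-trans (+≤+ z≤n) h) t<0)
    high≢outside (inj₂ (_ , hi)) h refl = ℤ.<-irrefl refl (ℤ.<-≤-trans h hi)

    small≢outside : ∀ {s t} → Outside m U t → Small s → t ≢ s
    small≢outside (inj₁ (_ , t<0)) (0≤s , _) refl = ℤ.<-irrefl refl (ℤ.<-≤-trans t<0 0≤s)
    small≢outside (inj₂ (U≤t , _)) (_ , s<U) refl = ℤ.<-irrefl refl (ℤ.<-≤-trans s<U U≤t)

    small : ∀ {n} → n < U → Small (+ n)
    small n<U = +≤+ z≤n , +<+ n<U

    d*i≤d*p′ : ∀ {i} → i < p → d * i ≤ d * p′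
    d*i≤d*p′ (s≤s i≤p′) = ℕ.*-monoʳ-≤ d i≤p′

    d*-mono-< : ∀ {i j} → i < j → d * i < d * j
    d*-mono-< = ℕ.*-monoʳ-< d {{ℕ.>-nonZero 1≤d}}

    S₂≤ : ∀ i → D + d * (p′ ∸ i) ≤ D + d * p′
    S₂≤ i = ℕ.+-monoʳ-≤ D (ℕ.*-monoʳ-≤ d (ℕ.m∸n≤m p′ i))

    d*i<D : ∀ {i} → i < p → d * i < D
    d*i<D i<p = ℕ.≤-<-trans (d*i≤d*p′ i<p) d*p′<D

    D≤U : D ≤ U
    D≤U = ℕ.<⇒≤ (ℕ.≤-<-trans (ℕ.m≤m+n D _) D+d*p′<U)

    S₁-small : ∀ {i} → i < p → Small (S₁ i)
    S₁-small i<p = small (ℕ.<-≤-trans (d*i<D i<p) D≤U)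

    S₂-small : ∀ i → Small (S₂ i)
    S₂-small i = small (ℕ.≤-<-trans (S₂≤ i) D+d*p′<U)

    peak-high : ∀ {i} → i < p → High (S₁ i ℤ.+ + a i)
    peak-high {i} i<p = +<+ (ℕ.<-≤-trans (ℕ.≤-<-trans (ℕ.m≤m+n _ _) (proj₁ (a-range i i<p))) (ℕ.m≤n+m (a i) (d * i)))

    8mp-mono : ∀ {i j} → i < j → 12 * m + 8 * m * suc i ≤ 12 * m + 8 * m * j
    8mp-mono i<j = ℕ.+-monoʳ-≤ (12 * m) (ℕ.*-monoʳ-≤ (8 * m) i<j)

    S₁<S₁ : ∀ {i j} → i < j → S₁ i ℤ.< S₁ j
    S₁<S₁ i<j = +<+ (d*-mono-< i<j)

    S₂<S₂ : ∀ {i j} → i < j → j < p → S₂ j ℤ.< S₂ i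
    S₂<S₂ i<j (s≤s j≤p′) = +<+ (ℕ.+-monoʳ-< D (d*-mono-< (ℕ.∸-monoʳ-< i<j j≤p′)))

    S₁<S₂ : ∀ {i} → i < p → ∀ j → S₁ i ℤ.< S₂ j
    S₁<S₂ i<p j = +<+ (ℕ.<-≤-trans (d*i<D i<p) (ℕ.m≤m+n D _))

    peak<peak : ∀ {i j} → i < j → j < p → S₁ i ℤ.+ + a i ℤ.< S₁ j ℤ.+ + a j
    peak<peak {i} {j} i<j j<p = ℤ.+-mono-< (S₁<S₁ i<j)
      (+<+ (ℕ.≤-<-trans (proj₂ (a-range i (ℕ.<-trans i<j j<p)))
        (ℕ.≤-<-trans (8mp-mono i<j) (proj₁ (a-range j j<p)))))

    valley<valley : ∀ {i j} → i < j → j < p → S₂ j ℤ.+ - + a′ j ℤ.< S₂ i ℤ.+ - + a′ i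
    valley<valley {i} {j} i<j j<p = ℤ.+-mono-< (S₂<S₂ i<j j<p) (ℤ.neg-mono-<
      (+<+ (ℕ.≤-<-trans (proj₂ (a′-range i (ℕ.<-trans i<j j<p)))
        (ℕ.≤-<-trans (8mp-mono (ℕ.+-monoʳ-< p i<j)) (proj₁ (a′-range j j<p))))))

    6m≤8mq : ∀ q → 6 * m ≤ 8 * m * (p + q)
    6m≤8mq q = ℕ.≤-trans (ℕ.*-monoˡ-≤ m (ℕ.m≤m+n 6 2)) (ℕ.m≤m*n (8 * m) (p + q))

    -- `a′ i` exceeds 12m + 8m(p + i), and the part 8m(p + i) alone outweighs the preceding sum,
    -- which is below `U` and so below 6m.
    valley-low : ∀ {i} → i < p → Low (S₂ i ℤ.+ - + a′ i)
    valley-low {i} i<p = subst (λ t → S₂ i ℤ.+ - + a′ i ℤ.< t) (eq (+ (12 * m)) (+ (8 * m * (p + i))))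
      (ℤ.+-mono-≤-< (+≤+ (ℕ.≤-trans (ℕ.<⇒≤ (ℕ.≤-<-trans (S₂≤ i) D+d*p′<U)) (ℕ.≤-trans U≤6m (6m≤8mq i))))
        (ℤ.neg-mono-< (+<+ (proj₁ (a′-range i i<p)))))
      where
      eq : ∀ s t → t ℤ.+ - (s ℤ.+ t) ≡ - s
      eq = ℤS.solve-∀

    -- A valley is no lower than -`a′ i`, which gives `L`. A peak adds at most 12m + 8mp to a sum
    -- below 6m, which gives `H`.
    L H : ℕ
    L = 12 * m + 8 * m * (p + p)
    H = 18 * m + 8 * m * p

    -L≤-12m : - + L ℤ.≤ - + (12 * m)
    -L≤-12m = ℤ.neg-mono-≤ (+≤+ (ℕ.m≤m+n _ _))

    12m≤H : 12 * m ≤ H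
    12m≤H = ℕ.≤-trans (ℕ.*-monoˡ-≤ m (ℕ.m≤m+n 12 6)) (ℕ.m≤m+n _ _)

    small-within : ∀ {t} → Small t → Within L H t
    small-within (0≤t , t<U) = ℤ.≤-trans (ℤ.≤-trans -L≤-12m -12m≤0) 0≤t ,
      ℤ.≤-trans (ℤ.<⇒≤ t<U) (+≤+ (ℕ.≤-trans U≤12m 12m≤H))

    outside-within : ∀ {t} → Outside m U t → Within L H t
    outside-within (inj₁ (lo , t<0)) = ℤ.≤-trans -L≤-12m lo , ℤ.≤-trans (ℤ.<⇒≤ t<0) (+≤+ z≤n)
    outside-within (inj₂ (U≤t , hi)) = ℤ.≤-trans (ℤ.≤-trans -L≤-12m -12m≤0) (ℤ.≤-trans (+≤+ z≤n) U≤t) ,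
      ℤ.≤-trans hi (+≤+ 12m≤H)

    peak-within : ∀ {i} → i < p → Within L H (S₁ i ℤ.+ + a i)
    peak-within {i} i<p = ℤ.≤-trans (ℤ.≤-trans -L≤-12m -12m≤0) (+≤+ z≤n) ,
      +≤+ (ℕ.≤-trans (ℕ.+-mono-≤ (ℕ.≤-trans (ℕ.<⇒≤ (ℕ.<-≤-trans (d*i<D i<p) D≤U)) U≤6m)
        (ℕ.≤-trans (proj₂ (a-range i i<p)) (8mp-mono i<p))) (ℕ.≤-reflexive (eq m p)))
      where
      eq : ∀ m p → 6 * m + (12 * m + 8 * m * p) ≡ 18 * m + 8 * m * p
      eq = ℕS.solve-∀

    valley-within : ∀ {i} → i < p → Within L H (S₂ i ℤ.+ - + a′ i)
    valley-within {i} i<p =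
      ℤ.≤-trans (ℤ.neg-mono-≤ (+≤+ (ℕ.≤-trans (proj₂ (a′-range i i<p)) (8mp-mono (ℕ.+-monoʳ-< p i<p)))))
        (ℤ.i≤j+i (- + a′ i) (S₂ i)) ,
      ℤ.<⇒≤ (ℤ.<-≤-trans (valley-low i<p) (ℤ.≤-trans -12m≤0 (+≤+ z≤n)))

    L+H<v : L + H < 2 * (m * 2 * 2) * (4 * p + 3) + 1
    -- The modulus exceeds `L + H` by exactly 1 + 2m + 8mp′; writing p as p′ + 1 makes this visibly
    -- positive.
    L+H<v = subst (L + H <_) (eq m p′) (ℕ.≤-<-trans (ℕ.m≤m+n (L + H) (2 * m + 8 * m * p′)) (ℕ.n<1+n _))
      where
      eq : ∀ m q → suc ((12 * m + 8 * m * (suc q + suc q)) + (18 * m + 8 * m * suc q) + (2 * m + 8 * m * q)) ≡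
        2 * (m * 2 * 2) * (4 * suc q + 3) + 1
      eq = ℕS.solve-∀

    distinct-peaks : AllPairs _≢_ (concat (applyUpTo peak p))
    distinct-peaks = AllPairs-concat-pairs p
      (λ i<p → ℤ.<⇒≢ (small<high (S₁-small i<p) (peak-high i<p)))
      (λ i<j _ → ℤ.<⇒≢ (S₁<S₁ i<j))
      (λ i<p j<p → ℤ.<⇒≢ (small<high (S₁-small i<p) (peak-high j<p)))
      (λ i<p j<p → ≢-sym (ℤ.<⇒≢ (small<high (S₁-small j<p) (peak-high i<p))))
      (λ i<j j<p → ℤ.<⇒≢ (peak<peak i<j j<p))

    distinct-valleys : AllPairs _≢_ (concat (applyUpTo valley p))
    distinct-valleys = AllPairs-concat-pairs p
      (λ {i} i<p → ≢-sym (ℤ.<⇒≢ (low<small (valley-low i<p) (S₂-small i))))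
      (λ i<j j<p → ≢-sym (ℤ.<⇒≢ (S₂<S₂ i<j j<p)))
      (λ {i} i<p j<p → ≢-sym (ℤ.<⇒≢ (low<small (valley-low j<p) (S₂-small i))))
      (λ {i} {j} i<p j<p → ℤ.<⇒≢ (low<small (valley-low i<p) (S₂-small j)))
      (λ i<j j<p → ≢-sym (ℤ.<⇒≢ (valley<valley i<j j<p)))

    distinct-peaks-valleys : All (λ s → All (s ≢_) (concat (applyUpTo valley p))) (concat (applyUpTo peak p))
    distinct-peaks-valleys = All-concat-pairs p
      (λ i<p → All-concat-pairs p
        (λ {j} j<p → ℤ.<⇒≢ (S₁<S₂ i<p j))
        (λ j<p → ≢-sym (ℤ.<⇒≢ (low<small (valley-low j<p) (S₁-small i<p)))))
      (λ i<p → All-concat-pairs p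
        (λ {j} j<p → ≢-sym (ℤ.<⇒≢ (small<high (S₂-small j) (peak-high i<p))))
        (λ j<p → ≢-sym (ℤ.<⇒≢ (low<high (valley-low j<p) (peak-high i<p)))))

    outside-distinct : ∀ {t} → Outside m U t → All (t ≢_) (concat (applyUpTo peak p) ++ concat (applyUpTo valley p))
    outside-distinct o = All.++⁺
      (All-concat-pairs p (λ i<p → small≢outside o (S₁-small i<p)) (λ i<p → high≢outside o (peak-high i<p)))
      (All-concat-pairs p (λ {i} i<p → small≢outside o (S₂-small i)) (λ i<p → low≢outside o (valley-low i<p)))

    R≢S₂ : ∀ i → + R ≢ S₂ i
    R≢S₂ i with R∉D+
    ... | inj₁ R<D     = ℤ.<⇒≢ (+<+ (ℕ.<-≤-trans R<D (ℕ.m≤m+n D _)))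
    ... | inj₂ D+d*p′<R = ≢-sym (ℤ.<⇒≢ (+<+ (ℕ.≤-<-trans (S₂≤ i) D+d*p′<R)))

    R-distinct : All (+ R ≢_) (concat (applyUpTo peak p) ++ concat (applyUpTo valley p))
    R-distinct = All.++⁺
      (All-concat-pairs p (λ i<p → ≢-sym (ℤ.<⇒≢ (+<+ (ℕ.≤-<-trans (d*i≤d*p′ i<p) d*p′<R))))
        (λ i<p → ℤ.<⇒≢ (small<high (small R<U) (peak-high i<p))))
      (All-concat-pairs p (λ {i} _ → R≢S₂ i)
        (λ i<p → ≢-sym (ℤ.<⇒≢ (low<small (valley-low i<p) (small R<U)))))

    sum-≢ : ∀ s {t} → t ≢ 0ℤ → s ≢ s ℤ.+ t
    sum-≢ s {t} t≢0 e = t≢0 (ℤ+.identityʳ-unique s t (sym e))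

    distinct-walk : AllPairs _≢_ (prefixSums (+ R) walk)
    distinct-walk = subst (AllPairs _≢_) (sym prefixSums-walk)
      ((sum-≢ (+ R) x≢0 ∷ ≢-sym (small≢outside outside₂ (small R<U)) ∷ R-distinct) ∷
       (sum-≢ (+ R ℤ.+ x) y≢0 ∷ outside-distinct outside₁) ∷
       outside-distinct outside₂ ∷
       AllPairs.++⁺ distinct-peaks distinct-valleys distinct-peaks-valleys)

    within-walk : All (Within L H) (prefixSums (+ R) walk)
    within-walk = subst (All (Within L H)) (sym prefixSums-walk)
      (small-within (small R<U) ∷ outside-within outside₁ ∷ outside-within outside₂ ∷
       All.++⁺ (All-concat-pairs p (λ i<p → small-within (S₁-small i<p)) peak-within)
               (All-concat-pairs p (λ {i} _ → small-within (S₂-small i)) valley-within))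

    Line-walk : Line (2 * (m * 2 * 2) * (4 * p + 3) + 1) (4 * p + 3) walk
    Line-walk = line walk-length walk-sum
      -- The sums were computed from `R`; removing this common translation leaves the sums from 0.
      (AllPairs.map (λ {s} {t} → incongruent-unshift (+ R) {s} {t}) (AllPairs.map⁻
        (subst (AllPairs _) (trans (cong (λ s → prefixSums s walk) (sym (ℤ.+-identityʳ (+ R)))) (prefixSums-shift (+ R) 0ℤ walk))
          (incongruents within-walk distinct-walk))))
      where
      incongruents : ∀ {ts} → All (Within L H) ts → AllPairs _≢_ ts →
        AllPairs (Incongruent (2 * (m * 2 * 2) * (4 * p + 3) + 1)) ts
      incongruents []        []        = []
      incongruents (w ∷ ws) (n ∷ ns) =
        All.zipWith (λ (w′ , s≢t) → within-incongruent L+H<v w w′ s≢t) (ws , n) ∷ incongruents ws ns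

-- The 3-part

-- lin c a b is the linear form c + a K + b r; we always have m = 1 + K + r, so that K and r run through
-- 0, …, m − 1 in opposite directions.
record Lin : Set where
  constructor lin
  field
    const coeffK coeffr : ℕ

⟦_⟧ : Lin → ℕ → ℕ → ℕ
⟦ lin c a b ⟧ K r = c + (a * K + b * r)

infixl 6 _⊕_
_⊕_ : Lin → Lin → Lin
lin c a b ⊕ lin c′ a′ b′ = lin (c + c′) (a + a′) (b + b′)

infix 7 _·m
_·m : ℕ → Lin
u ·m = lin u u u

infix 4 _≼_ _≼?_
-- Coefficientwise comparison suffices because K and r are natural numbers. Being decidable, it
-- settles the inequalities about the 3-part by evaluation, uniformly in m.
_≼_ : Lin → Lin → Set
lin c a b ≼ lin c′ a′ b′ = c ≤ c′ × a ≤ a′ × b ≤ b′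

_≼?_ : ∀ f g → Dec (f ≼ g)
lin c a b ≼? lin c′ a′ b′ = c ℕ.≤? c′ ×-dec a ℕ.≤? a′ ×-dec b ℕ.≤? b′

Term : Set
Term = Bool × Lin

flip : Bool → ℤ → ℤ
flip false t = t
flip true  t = - t

value : Term → ℕ → ℕ → ℤ
value (σ , f) K r = flip σ (+ ⟦ f ⟧ K r)

positive negative : Term → Lin
positive (false , f) = f
positive (true  , f) = 0 ·m
negative (false , f) = 0 ·m
negative (true  , f) = f

-- The condition `Outside` for the difference f - g, with every term moved to the side where its
-- coefficients are natural numbers.
OutsideLin : ℕ → Lin → Lin → Set
OutsideLin u f g = (f ⊕ lin 1 0 0 ≼ g × g ≼ f ⊕ 12 ·m) ⊎ (g ⊕ u ·m ≼ f × f ≼ g ⊕ 12 ·m)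

outsideLin? : ∀ u f g → Dec (OutsideLin u f g)
outsideLin? u f g = (f ⊕ lin 1 0 0 ≼? g ×-dec g ≼? f ⊕ 12 ·m) ⊎-dec (g ⊕ u ·m ≼? f ×-dec f ≼? g ⊕ 12 ·m)

module _ (K r : ℕ) where

  ⟦⟧-⊕ : ∀ f g → ⟦ f ⊕ g ⟧ K r ≡ ⟦ f ⟧ K r + ⟦ g ⟧ K r
  ⟦⟧-⊕ (lin c a b) (lin c′ a′ b′) = eq c a b c′ a′ b′ K r
    where
    eq : ∀ c a b c′ a′ b′ K r → c + c′ + ((a + a′) * K + (b + b′) * r) ≡
      c + (a * K + b * r) + (c′ + (a′ * K + b′ * r))
    eq = ℕS.solve-∀

  ⟦⟧-·m : ∀ u → ⟦ u ·m ⟧ K r ≡ u * suc (K + r)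
  ⟦⟧-·m u = eq u K r
    where
    eq : ∀ u K r → u + (u * K + u * r) ≡ u * suc (K + r)
    eq = ℕS.solve-∀

  ⟦⟧-mono : ∀ {f g} → f ≼ g → ⟦ f ⟧ K r ≤ ⟦ g ⟧ K r
  ⟦⟧-mono (c≤ , a≤ , b≤) = ℕ.+-mono-≤ c≤ (ℕ.+-mono-≤ (ℕ.*-monoˡ-≤ K a≤) (ℕ.*-monoˡ-≤ r b≤))

  value-split : ∀ t → value t K r ≡ + ⟦ positive t ⟧ K r ℤ.- + ⟦ negative t ⟧ K r
  value-split (false , f) = sym (ℤ.+-identityʳ _)
  value-split (true  , f) = sym (ℤ.+-identityˡ _)

  value-≢0 : ∀ t → lin 1 0 0 ≼ positive t ⊕ negative t → value t K r ≢ 0ℤ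
  value-≢0 (false , lin c a b) (1≤c , _) e with ℕ.≤-trans 1≤c (ℕ.≤-reflexive (ℕ.+-identityʳ c)) | ℤ.+-injective e
  ... | s≤s _ | ()
  value-≢0 (true  , lin (suc c) a b) (_ , _) ()

  module _ {m : ℕ} (m≡ : m ≡ suc (K + r)) where

    ⟦⟧-⊕·m : ∀ f u → ⟦ f ⊕ u ·m ⟧ K r ≡ ⟦ f ⟧ K r + u * m
    ⟦⟧-⊕·m f u rewrite m≡ = trans (⟦⟧-⊕ f (u ·m)) (cong (λ s → ⟦ f ⟧ K r + s) (⟦⟧-·m u))

    outside : ∀ {u} f g → OutsideLin u f g → Outside m (u * m) (+ ⟦ f ⟧ K r ℤ.- + ⟦ g ⟧ K r)
    outside {u} f g (inj₁ (f<g , g≤)) = inj₁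
      ( subst (λ s → s ℤ.≤ F ℤ.- G) (cancel F (+ (12 * m))) (ℤ.+-monoʳ-≤ F (ℤ.neg-mono-≤
          (+≤+ (subst (⟦ g ⟧ K r ≤_) (⟦⟧-⊕·m f 12) (⟦⟧-mono g≤)))))
      , subst (λ s → F ℤ.- G ℤ.< s) (ℤ.+-inverseʳ F) (ℤ.+-monoʳ-< F (ℤ.neg-mono-<
          (+<+ (subst (_≤ ⟦ g ⟧ K r) (trans (⟦⟧-⊕ f (lin 1 0 0)) (ℕ.+-comm _ 1)) (⟦⟧-mono f<g))))) )
      where
      F = + ⟦ f ⟧ K r
      G = + ⟦ g ⟧ K r
      cancel : ∀ F c → F ℤ.- (F ℤ.+ c) ≡ - c
      cancel = ℤS.solve-∀
    outside {u} f g (inj₂ (g≤ , f≤)) = inj₂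
      ( subst (λ s → s ℤ.≤ F ℤ.- G) (cancel G (+ (u * m))) (ℤ.+-monoˡ-≤ (- G)
          (+≤+ (subst (_≤ ⟦ f ⟧ K r) (⟦⟧-⊕·m g u) (⟦⟧-mono g≤))))
      , subst (λ s → F ℤ.- G ℤ.≤ s) (cancel G (+ (12 * m))) (ℤ.+-monoˡ-≤ (- G)
          (+≤+ (subst (⟦ f ⟧ K r ≤_) (⟦⟧-⊕·m g 12) (⟦⟧-mono f≤)))) )
      where
      F = + ⟦ f ⟧ K r
      G = + ⟦ g ⟧ K r
      cancel : ∀ G c → G ℤ.+ c ℤ.- G ≡ c
      cancel = ℤS.solve-∀

    -- Reduces a line of the 3-part to its coefficients: for concrete terms the sum condition is
    -- `refl`, and the implicit `True` arguments are found by running the decision procedures.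
    triple : ∀ u t₁ t₂ t₃ →
      positive t₁ ⊕ positive t₂ ⊕ positive t₃ ⊕ 3 ·m ≡ negative t₁ ⊕ negative t₂ ⊕ negative t₃ →
      {True (lin 1 0 0 ≼? positive t₁ ⊕ negative t₁)} → {True (lin 1 0 0 ≼? positive t₂ ⊕ negative t₂)} →
      {True (outsideLin? u (3 ·m ⊕ positive t₁) (negative t₁))} →
      {True (outsideLin? u (3 ·m ⊕ positive t₁ ⊕ positive t₂) (negative t₁ ⊕ negative t₂))} →
      Triple m (3 * m) (u * m) (value t₁ K r) (value t₂ K r) (value t₃ K r)
    triple u t₁ t₂ t₃ e {w₁} {w₂} {w₃} {w₄} = record
      { sum = trans (cong₂ ℤ._+_ (cong₂ ℤ._+_ (value-split t₁) (value-split t₂)) (value-split t₃))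
          (sum-eq (+ P₁) (+ N₁) (+ P₂) (+ N₂) (+ P₃) (+ N₃) (+ (3 * m)) (cong +_ e′))
      ; x≢0 = value-≢0 t₁ (toWitness w₁)
      ; y≢0 = value-≢0 t₂ (toWitness w₂)
      ; outside₁ = subst (Outside m (u * m)) (sym eq₁) (outside (3 ·m ⊕ positive t₁) (negative t₁) (toWitness w₃))
      ; outside₂ = subst (Outside m (u * m)) (sym eq₂)
          (outside (3 ·m ⊕ positive t₁ ⊕ positive t₂) (negative t₁ ⊕ negative t₂) (toWitness w₄))
      }
      where
      P₁ = ⟦ positive t₁ ⟧ K r
      P₂ = ⟦ positive t₂ ⟧ K r
      P₃ = ⟦ positive t₃ ⟧ K r
      N₁ = ⟦ negative t₁ ⟧ K r
      N₂ = ⟦ negative t₂ ⟧ K r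
      N₃ = ⟦ negative t₃ ⟧ K r
      ⊕₃ : ∀ f g h → ⟦ f ⊕ g ⊕ h ⟧ K r ≡ ⟦ f ⟧ K r + ⟦ g ⟧ K r + ⟦ h ⟧ K r
      ⊕₃ f g h = trans (⟦⟧-⊕ (f ⊕ g) h) (cong (λ s → s + ⟦ h ⟧ K r) (⟦⟧-⊕ f g))
      3m : ⟦ 3 ·m ⟧ K r ≡ 3 * m
      3m = trans (⟦⟧-·m 3) (cong (λ s → 3 * s) (sym m≡))
      e′ : P₁ + P₂ + P₃ + 3 * m ≡ N₁ + N₂ + N₃
      e′ = trans (trans (cong (λ s → s + 3 * m) (sym (⊕₃ (positive t₁) (positive t₂) (positive t₃))))
             (sym (⟦⟧-⊕·m (positive t₁ ⊕ positive t₂ ⊕ positive t₃) 3)))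
           (trans (cong (λ f → ⟦ f ⟧ K r) e) (⊕₃ (negative t₁) (negative t₂) (negative t₃)))
      sum-eq : ∀ P₁ N₁ P₂ N₂ P₃ N₃ R → P₁ ℤ.+ P₂ ℤ.+ P₃ ℤ.+ R ≡ N₁ ℤ.+ N₂ ℤ.+ N₃ →
        (P₁ ℤ.- N₁) ℤ.+ (P₂ ℤ.- N₂) ℤ.+ (P₃ ℤ.- N₃) ≡ - R
      sum-eq P₁ N₁ P₂ N₂ P₃ N₃ R h = trans (gather P₁ N₁ P₂ N₂ P₃ N₃ R)
          (trans (cong (λ s → s ℤ.- (N₁ ℤ.+ N₂ ℤ.+ N₃) ℤ.- R) h) (cancel (N₁ ℤ.+ N₂ ℤ.+ N₃) R))
        where
        gather : ∀ P₁ N₁ P₂ N₂ P₃ N₃ R → (P₁ ℤ.- N₁) ℤ.+ (P₂ ℤ.- N₂) ℤ.+ (P₃ ℤ.- N₃) ≡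
          P₁ ℤ.+ P₂ ℤ.+ P₃ ℤ.+ R ℤ.- (N₁ ℤ.+ N₂ ℤ.+ N₃) ℤ.- R
        gather = ℤS.solve-∀
        cancel : ∀ N R → N ℤ.- N ℤ.- R ≡ - R
        cancel = ℤS.solve-∀
      eq₁ : + (3 * m) ℤ.+ value t₁ K r ≡ + ⟦ 3 ·m ⊕ positive t₁ ⟧ K r ℤ.- + N₁
      eq₁ = trans (cong (λ s → + (3 * m) ℤ.+ s) (value-split t₁))
        (trans (sym (ℤ.+-assoc (+ (3 * m)) (+ P₁) (- + N₁)))
          (cong (λ s → + s ℤ.- + N₁) (sym (trans (⟦⟧-⊕ (3 ·m) (positive t₁)) (cong (λ s → s + P₁) 3m)))))
      eq₂ : + (3 * m) ℤ.+ value t₁ K r ℤ.+ value t₂ K r ≡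
        + ⟦ 3 ·m ⊕ positive t₁ ⊕ positive t₂ ⟧ K r ℤ.- + ⟦ negative t₁ ⊕ negative t₂ ⟧ K r
      eq₂ = trans (cong₂ (λ s t → + (3 * m) ℤ.+ s ℤ.+ t) (value-split t₁) (value-split t₂))
        (trans (regroup (+ (3 * m)) (+ P₁) (+ N₁) (+ P₂) (+ N₂))
          (cong₂ (λ s t → + s ℤ.- + t)
            (sym (trans (⊕₃ (3 ·m) (positive t₁) (positive t₂)) (cong (λ s → s + P₁ + P₂) 3m)))
            (sym (⟦⟧-⊕ (negative t₁) (negative t₂)))))
        where
        regroup : ∀ R P₁ N₁ P₂ N₂ → R ℤ.+ (P₁ ℤ.- N₁) ℤ.+ (P₂ ℤ.- N₂) ≡ R ℤ.+ P₁ ℤ.+ P₂ ℤ.- (N₁ ℤ.+ N₂)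
        regroup = ℤS.solve-∀

-- The array

odd : ℕ → Bool
odd 0             = false
odd 1             = true
odd (suc (suc n)) = odd n

bit : Bool → ℕ
bit false = 0
bit true  = 1

-- As m = 1 + K + r, these are um + 1 + K, um + 1 + r, um + 2 + 2K and um + 1 + 2r. Each of the
-- first two runs through m consecutive values; `evens` and `odds` together run through 2m.
ascending descending evens odds : ℕ → Lin
ascending  u = lin (suc u) (suc u) u
descending u = lin (suc u) u (suc u)
evens      u = lin (2 + u) (2 + u) u
odds       u = lin (suc u) u (2 + u)

-- The 3-part consists of m copies (K = 0, …, m − 1) of this 4 × 4 pattern, whose rows are indexed by the
-- first two and whose columns by the last two arguments. Its rows and columns have sum ∓3m (−3m for even index).
form : Bool → Bool → Bool → Bool → Maybe Term
form false false false false = just (true  , evens 10)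
form false false false true  = just (false , ascending 4)
form false false true  false = just (false , ascending 3)
form false false true  true  = nothing
form false true  false false = nothing
form false true  false true  = just (true  , descending 8)
form false true  true  false = just (false , ascending 0)
form false true  true  true  = just (false , odds 10)
form true  false false false = just (false , ascending 2)
form true  false false true  = nothing
form true  false true  false = just (true  , evens 6)
form true  false true  true  = just (false , ascending 1)
form true  true  false false = just (false , ascending 5)
form true  true  false true  = just (false , odds 6)
form true  true  true  false = nothing
form true  true  true  true  = just (true  , descending 9)

bits : Bool → Bool → Bool → ℕ
bits x y z = 4 * bit x + 2 * bit y + bit z

bits≤7 : ∀ x y z → bits x y z ≤ 7
bits≤7 false false false = ℕ.m≤m+n _ _
bits≤7 false false true  = ℕ.m≤m+n _ _
bits≤7 false true  false = ℕ.m≤m+n _ _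
bits≤7 false true  true  = ℕ.m≤m+n _ _
bits≤7 true  false false = ℕ.m≤m+n _ _
bits≤7 true  false true  = ℕ.m≤m+n _ _
bits≤7 true  true  false = ℕ.m≤m+n _ _
bits≤7 true  true  true  = ℕ.m≤m+n _ _

-- Parity and halving of indices

odd-+ : ∀ a b → odd (a + b) ≡ odd a xor odd b
odd-+ zero          b = refl
odd-+ (suc zero)    zero          = refl
odd-+ (suc zero)    (suc zero)    = refl
odd-+ (suc zero)    (suc (suc b)) = odd-+ 1 b
odd-+ (suc (suc a)) b = odd-+ a b

odd-*2 : ∀ a → odd (a * 2) ≡ false
odd-*2 zero    = refl
odd-*2 (suc a) = odd-*2 a

odd-1+*2 : ∀ a → odd (suc (a * 2)) ≡ true
odd-1+*2 zero    = refl
odd-1+*2 (suc a) = odd-1+*2 a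

⌊*2/2⌋ : ∀ a → ⌊ a * 2 /2⌋ ≡ a
⌊*2/2⌋ zero    = refl
⌊*2/2⌋ (suc a) = cong suc (⌊*2/2⌋ a)

⌊1+*2/2⌋ : ∀ a → ⌊ suc (a * 2) /2⌋ ≡ a
⌊1+*2/2⌋ zero    = refl
⌊1+*2/2⌋ (suc a) = cong suc (⌊1+*2/2⌋ a)

⌊/2⌋< : ∀ {a} b → a < b * 2 → ⌊ a /2⌋ < b
⌊/2⌋< {zero}        (suc b) _ = ℕ.z<s
⌊/2⌋< {suc zero}    (suc b) _ = ℕ.z<s
⌊/2⌋< {suc (suc a)} (suc b) (s≤s (s≤s a<)) = s≤s (⌊/2⌋< b a<)

even-suc : ∀ I → odd I ≡ false → odd (suc I) ≡ true × ⌊ suc I /2⌋ ≡ ⌊ I /2⌋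
even-suc zero          e = refl , refl
even-suc (suc (suc I)) e = proj₁ (even-suc I e) , cong suc (proj₂ (even-suc I e))

even-suc< : ∀ {I} b → odd I ≡ false → I < b * 2 → suc I < b * 2
even-suc< {zero}        (suc b) e _ = s≤s (s≤s z≤n)
even-suc< {suc (suc I)} (suc b) e (s≤s (s≤s I<)) = s≤s (s≤s (even-suc< b e I<))

-- The cells of the array

module Construction (m p′ : ℕ) (2+p≤m : 2 + suc p′ ≤ m) where

  p = suc p′
  N = m * 2

  instance
    m≢0 : NonZero m
    m≢0 = ℕ.>-nonZero (ℕ.<-≤-trans ℕ.z<s 2+p≤m)
    N≢0 : NonZero N
    N≢0 = ℕ.m*n≢0 m 2

  -- The eight entries with the same K on an antidiagonal of blocks differ in three bits, whose weights give the
  -- steps: d = 1, e = 2 on the sides, d = m, e = 4m at the first corner and d = 2m, e = m at the second one,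
  -- where complementing δ makes the row step positive although the block is negated.
  code : (half corner P ε δ : Bool) → ℕ
  code _     false P ε δ = bits P ε δ
  code false true  P ε δ = bits ε P δ
  code true  true  P ε δ = bits P (not δ) ε

  offset : (half corner : Bool) → ℕ → (P ε δ : Bool) → ℕ
  offset h false K P ε δ = 8 * K + code h false P ε δ
  offset h true  K P ε δ = K + m * code h true P ε δ

  index : Bool → ℕ → ℕ
  index false i = i
  index true  i = p + i

  -- Every antidiagonal takes 8m consecutive values. The test `suc i ≡ᵇ p` singles out the last
  -- antidiagonal of each half, its corner. The bits are complemented since both d and e are added
  -- in the top left cell.
  magnitude : Bool → ℕ → ℕ → (P ρ γ : Bool) → ℕ
  magnitude h i K P ρ γ = suc (12 * m + 8 * m * index h i + offset h (suc i ≡ᵇ p) K P (not ρ) (not γ))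

  pairEntry : Bool → ℕ → ℕ → (P ρ γ : Bool) → Maybe ℤ
  pairEntry h i K P ρ γ = just (flip ρ (flip γ (flip h (+ magnitude h i K P ρ γ))))

  pairBlock : ℕ → ℕ → (P ρ γ : Bool) → Maybe ℤ
  pairBlock i K P ρ γ with i ℕ.<? p | i ∸ p ℕ.<? p
  ... | yes _ | _     = pairEntry false i K P ρ γ
  ... | no _  | yes _ = pairEntry true (i ∸ p) K P ρ γ
  ... | no _  | no _  = nothing

  formEntry : ℕ → (P ρ Q γ : Bool) → Maybe ℤ
  formEntry K P ρ Q γ = Maybe.map (λ t → value t K (m ∸ suc K)) (form P ρ Q γ)

  -- The entry at the cell (ρ , γ) of a 2 × 2 block on the s-th antidiagonal of blocks and in block row 2K + P.
  block : (s K : ℕ) (P ρ γ : Bool) → Maybe ℤ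
  block 0 K false ρ γ = formEntry K false ρ false γ
  block 0 K true  ρ γ = nothing
  block 1 K false ρ γ = formEntry K false ρ true γ
  block 1 K true  ρ γ = formEntry K true ρ false γ
  block 2 K false ρ γ = nothing
  block 2 K true  ρ γ = formEntry K true ρ true γ
  block (suc (suc (suc i))) K P ρ γ = pairBlock i K P ρ γ

  blockAt : (s I : ℕ) (ρ γ : Bool) → Maybe ℤ
  blockAt s I = block s ⌊ I /2⌋ (odd I)

  -- Block row plus block column is constant modulo `N` along an antidiagonal. With the shift by 2,
  -- the K-th copy of the 4 × 4 pattern occupies block columns N - 2K - 2 and N - 2K - 1.
  cell : ℕ → ℕ → Maybe ℤ
  cell a b = blockAt ((⌊ b /2⌋ + (⌊ a /2⌋ + 2)) % N) ⌊ a /2⌋ (odd a) (odd b)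

  array : Array (m * 2 * 2)
  array i j = cell (toℕ i) (toℕ j)

  pairBlock-first : ∀ {i} → i < p → ∀ K P ρ γ → pairBlock i K P ρ γ ≡ pairEntry false i K P ρ γ
  pairBlock-first {i} i<p K P ρ γ with i ℕ.<? p | i ∸ p ℕ.<? p
  ... | yes _  | _ = refl
  ... | no i≮p | _ = ⊥-elim (i≮p i<p)

  pairBlock-second : ∀ {i} → i < p → ∀ K P ρ γ → pairBlock (p + i) K P ρ γ ≡ pairEntry true i K P ρ γ
  pairBlock-second {i} i<p K P ρ γ with (p + i) ℕ.<? p | (p + i) ∸ p ℕ.<? p
  ... | yes p+i<p | _     = ⊥-elim (ℕ.m+n≮m p i p+i<p)
  ... | no _      | yes _ = cong (λ i → pairEntry true i K P ρ γ) (ℕ.m+n∸m≡n p i)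
  ... | no _      | no ≮p = ⊥-elim (≮p (subst (_< p) (sym (ℕ.m+n∸m≡n p i)) i<p))

  pairBlock-none : ∀ i K P ρ γ → pairBlock (p + (p + i)) K P ρ γ ≡ nothing
  pairBlock-none i K P ρ γ with (p + (p + i)) ℕ.<? p | (p + (p + i)) ∸ p ℕ.<? p
  ... | yes <p | _      = ⊥-elim (ℕ.m+n≮m p _ <p)
  ... | no _   | yes <p = ⊥-elim (ℕ.m+n≮m p i (subst (_< p) (ℕ.m+n∸m≡n p (p + i)) <p))
  ... | no _   | no _   = refl

  offset-bound : ∀ h c {K} → K < m → ∀ P ε δ → offset h c K P ε δ < 8 * m
  offset-bound h false {K} K<m P ε δ = ℕ.≤-trans
    (s≤s (ℕ.+-monoʳ-≤ (8 * K) (bits≤7 P ε δ)))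
    (ℕ.≤-trans (ℕ.≤-reflexive (eq K)) (ℕ.*-monoʳ-≤ 8 K<m))
    where
    eq : ∀ K → suc (8 * K + 7) ≡ 8 * suc K
    eq = ℕS.solve-∀
  offset-bound h true {K} K<m P ε δ = ℕ.<-≤-trans
    (ℕ.+-mono-<-≤ K<m (ℕ.*-monoʳ-≤ m (code≤7 h)))
    (ℕ.≤-reflexive (eq m))
    where
    code≤7 : ∀ h → code h true P ε δ ≤ 7
    code≤7 false = bits≤7 ε P δ
    code≤7 true  = bits≤7 P (not δ) ε
    eq : ∀ m → m + m * 7 ≡ 8 * m
    eq = ℕS.solve-∀

  magnitude-range : ∀ h i {K} → K < m → ∀ P ρ γ →
    12 * m + 8 * m * index h i < magnitude h i K P ρ γ ×
    magnitude h i K P ρ γ ≤ 12 * m + 8 * m * suc (index h i)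
  magnitude-range h i K<m P ρ γ = s≤s (ℕ.m≤m+n _ _) ,
    ℕ.≤-trans (ℕ.≤-reflexive (sym (ℕ.+-suc _ _)))
      (ℕ.≤-trans (ℕ.+-monoʳ-≤ (12 * m + 8 * m * index h i) (offset-bound h (suc i ≡ᵇ p) K<m P (not ρ) (not γ)))
        (ℕ.≤-reflexive (eq m (index h i))))
    where
    eq : ∀ m u → 12 * m + 8 * m * u + 8 * m ≡ 12 * m + 8 * m * suc u
    eq = ℕS.solve-∀

  side≢corner : ∀ {i} → i < p′ → (suc i ≡ᵇ p) ≡ false
  side≢corner {i} i<p′ with i ≡ᵇ p′ in e
  ... | false = refl
  ... | true  = ⊥-elim (ℕ.<⇒≢ i<p′ (ℕ.≡ᵇ⇒≡ i p′ (subst T (sym e) _)))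

  corner : (suc p′ ≡ᵇ p) ≡ true
  corner with p′ ≡ᵇ p′ in e
  ... | true  = refl
  ... | false = ⊥-elim (subst T e (ℕ.≡⇒≡ᵇ p′ p′ refl))

  3+p+p≤N : 3 + (p + p) ≤ N
  3+p+p≤N = ℕ.≤-trans (ℕ.≤-trans (ℕ.n≤1+n _) (ℕ.≤-reflexive (eq p′))) (ℕ.*-monoˡ-≤ 2 2+p≤m)
    where
    eq : ∀ q → 4 + (suc q + suc q) ≡ (3 + q) * 2
    eq = ℕS.solve-∀

  k v : ℕ
  k = 4 * p + 3
  v = 2 * (m * 2 * 2) * k + 1

  Line-flip : ∀ σ {xs} → Line v k xs → Line v k (map (flip σ) xs)
  Line-flip false {xs} l = subst (Line v k) (sym (map-id xs)) l
  Line-flip true       l = Line-neg l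

  module _ {d D R U : ℕ} {x y z : ℤ} {a y₁ a′ y′ : ℕ → ℕ} where

    open Walk m p′ d D R U x y z a y₁ a′ y′ using (walk; line₁; line₂; Hypotheses; Line-walk)

    -- Cuts the antidiagonals into 3, p, p and an empty remainder, and matches the first three
    -- groups with the segments of `walk`, up to the sign `σ`.
    Line-blocks : Hypotheses → ∀ (f : ℕ → List ℤ) σ →
      f 0 ++ f 1 ++ f 2 ≡ map (flip σ) (x ∷ y ∷ z ∷ []) →
      (∀ i → i < p → f (3 + i) ≡ map (flip σ) (+ a i ∷ - + y₁ i ∷ [])) →
      (∀ i → i < p → f (3 + (p + i)) ≡ map (flip σ) (- + a′ i ∷ + y′ i ∷ [])) →
      (∀ i → f (3 + (p + (p + i))) ≡ []) →
      Line v k (concat (applyUpTo f N))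
    Line-blocks hyp f σ f₃ f₁ f₂ f∅ = subst (Line v k) (sym blocks≡walk) (Line-flip σ (Line-walk hyp))
      where
      r : ℕ
      r = N ∸ (3 + (p + p))
      N≡ : N ≡ 3 + (p + (p + r))
      N≡ = trans (sym (ℕ.m+[n∸m]≡n 3+p+p≤N)) (cong (λ u → 3 + u) (ℕ.+-assoc p p r))
      empty : ∀ (g : ℕ → List ℤ) n → (∀ i → g i ≡ []) → concat (applyUpTo g n) ≡ []
      empty g zero    h = refl
      empty g (suc n) h = cong₂ _++_ (h 0) (empty (g ∘ suc) n (h ∘ suc))
      f≡ : ∀ (g w : ℕ → List ℤ) → (∀ i → i < p → g i ≡ map (flip σ) (w i)) →
        concat (applyUpTo g p) ≡ map (flip σ) (concat (applyUpTo w p))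
      f≡ g w h = trans (cong concat (trans (applyUpTo-cong p h) (sym (map-applyUpTo w (map (flip σ)) p))))
        (concat-map (applyUpTo w p))
      split : ∀ (g : ℕ → List ℤ) n → concat (applyUpTo g (p + n)) ≡
        concat (applyUpTo g p) ++ concat (applyUpTo (λ i → g (p + i)) n)
      split g n = trans (cong concat (applyUpTo-+ g p n)) (sym (concat-++ (applyUpTo g p) _))
      pairs : concat (applyUpTo (λ i → f (3 + i)) (p + (p + r))) ≡ map (flip σ) (line₁ ++ line₂)
      pairs = trans (split (λ i → f (3 + i)) (p + r)) (trans (cong₂ _++_ (f≡ _ _ f₁)
        (trans (split (λ i → f (3 + (p + i))) r) (trans (cong₂ _++_ (f≡ _ _ f₂) (empty _ r f∅)) (++-identityʳ _))))
        (sym (map-++ (flip σ) line₁ line₂)))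
      blocks≡walk : concat (applyUpTo f N) ≡ map (flip σ) walk
      blocks≡walk = trans (cong (λ n → concat (applyUpTo f n)) N≡)
        (trans (sym (trans (++-assoc (f 0) (f 1 ++ f 2) _) (cong (λ xs → f 0 ++ xs) (++-assoc (f 1) (f 2) _))))
          (cong₂ _++_ f₃ pairs))

  -- Rows and columns as walks

  K+r≡m : ∀ {K} → K < m → m ≡ suc (K + (m ∸ suc K))
  K+r≡m K<m = sym (ℕ.m+[n∸m]≡n K<m)

  row column : ℕ → ℕ → Bool → Bool → List ℤ
  row    s K P ρ = catMaybes (block s K P ρ false ∷ block s K P ρ true ∷ [])
  column s K P γ = catMaybes (block s K P false γ ∷ block s K P true γ ∷ [])

  row-triple : ∀ {K} → K < m → ∀ P ρ → ∃ λ x → ∃₂ λ y z → Triple m (3 * m) (5 * m) x y z ×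
    row 0 K P ρ ++ row 1 K P ρ ++ row 2 K P ρ ≡ map (flip ρ) (x ∷ y ∷ z ∷ [])
  row-triple {K} K<m = λ where
      false false → _ , _ , _ , check (true  , evens 10)     (false , ascending 4) (false , ascending 3)  refl , refl
      false true  → _ , _ , _ , check (false , descending 8) (true  , ascending 0) (true  , odds 10)      refl , refl
      true  false → _ , _ , _ , check (false , ascending 2)  (true  , evens 6)     (false , ascending 1)  refl , refl
      true  true  → _ , _ , _ , check (true  , ascending 5)  (true  , odds 6)      (false , descending 9) refl , refl
    where
    -- The bound is 5m and not 6m: in the third row of the pattern the first intermediate sum is 3m
    -- + (2m + K + 1).
    check = triple K (m ∸ suc K) (K+r≡m K<m) 5

  -- For `Q` true the first of the three antidiagonals is empty in this block column, otherwise the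
  -- third; `K′` is the index of the empty block and thus arbitrary.
  column-triple : ∀ {K} → K < m → ∀ Q γ {K′} → ∃ λ x → ∃₂ λ y z → Triple m (3 * m) (6 * m) x y z ×
    (if Q then column 0 K′ true γ ++ column 1 K false γ ++ column 2 K true γ
          else column 0 K false γ ++ column 1 K true γ ++ column 2 K′ false γ) ≡ map (flip γ) (x ∷ y ∷ z ∷ [])
  column-triple {K} K<m = λ where
      false false → _ , _ , _ , check (true  , evens 10)    (false , ascending 2)  (false , ascending 5)  refl , refl
      false true  → _ , _ , _ , check (true  , ascending 4) (false , descending 8) (true  , odds 6)       refl , refl
      true  false → _ , _ , _ , check (false , ascending 3) (false , ascending 0)  (true  , evens 6)      refl , refl
      true  true  → _ , _ , _ , check (true  , odds 10)     (true  , ascending 1)  (false , descending 9) refl , refl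
    where
    check = triple K (m ∸ suc K) (K+r≡m K<m) 6

  p′<m : p′ < m
  p′<m = ℕ.<-trans (ℕ.n<1+n p′) (ℕ.<-trans (ℕ.n<1+n p) 2+p≤m)

  side-diff : ∀ h i {K P ρ γ P′ ρ′ γ′ d} → i < p′ →
    bits P (not ρ) (not γ) ≡ bits P′ (not ρ′) (not γ′) + d →
    magnitude h i K P ρ γ ≡ magnitude h i K P′ ρ′ γ′ + d
  side-diff h i {K} {d = d} i<p′ e rewrite side≢corner i<p′ | e =
    eq (12 * m + 8 * m * index h i) (8 * K) _ d
    where
    eq : ∀ b k c d → suc (b + (k + (c + d))) ≡ suc (b + (k + c)) + d
    eq = ℕS.solve-∀

  -- At a corner the code is multiplied by m, so entries of a block differ by multiples of m.
  -- Allowing a summand on both sides avoids subtraction, with `s` = 3 supplying `R` at the second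
  -- corner.
  corner-diff : ∀ h {K P ρ γ P′ ρ′ γ′} s t → code h true P (not ρ) (not γ) + s ≡ code h true P′ (not ρ′) (not γ′) + t →
    magnitude h p′ K P ρ γ + s * m ≡ magnitude h p′ K P′ ρ′ γ′ + t * m
  corner-diff h {K} s t e rewrite corner =
    trans (eq b K m _ s) (trans (cong (λ c → suc (b + (K + m * c))) e) (sym (eq b K m _ t)))
    where
    b = 12 * m + 8 * m * index h p′
    eq : ∀ b K m c s → suc (b + (K + m * c)) + s * m ≡ suc (b + (K + m * (c + s)))
    eq = ℕS.solve-∀

  bits-1 : ∀ x y → bits x y true ≡ bits x y false + 1
  bits-1 x y = sym (ℕ.+-assoc _ 0 1)

  bits-2 : ∀ x z → bits x true z ≡ bits x false z + 2
  bits-2 x z = eq (4 * bit x) (bit z)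
    where
    eq : ∀ x z → x + 2 * 1 + z ≡ x + 2 * 0 + z + 2
    eq = ℕS.solve-∀

  bits-4 : ∀ y z → bits true y z ≡ bits false y z + 4
  bits-4 y z = eq (2 * bit y) (bit z)
    where
    eq : ∀ y z → 4 * 1 + y + z ≡ 4 * 0 + y + z + 4
    eq = ℕS.solve-∀

  module _ {d D₀ U₀ : ℕ} (1≤d : 1 ≤ d) (d≤D₀ : d ≤ D₀) (D₀+d≤U₀ : D₀ + d ≤ U₀) (U₀≤6 : U₀ ≤ 6) (3<U₀ : 3 < U₀)
    (d≤3 : d ≤ 3) (3∉ : 3 < D₀ ⊎ D₀ + d ≤ 3) {x y z : ℤ} {a y₁ a′ y′ : ℕ → ℕ} where

    open Walk m p′ d (D₀ * m) (3 * m) (U₀ * m) x y z a y₁ a′ y′ using (Hypotheses)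

    private
      d*p′<d*m : d * p′ < d * m
      d*p′<d*m = ℕ.*-monoʳ-< d {{ℕ.>-nonZero 1≤d}} p′<m

      D+d*p′< : ∀ {u} → D₀ + d ≤ u → D₀ * m + d * p′ < u * m
      D+d*p′< le = ℕ.<-≤-trans (ℕ.+-monoʳ-< (D₀ * m) d*p′<d*m)
        (ℕ.≤-trans (ℕ.≤-reflexive (sym (ℕ.*-distribʳ-+ m D₀ d))) (ℕ.*-monoˡ-≤ m le))

    -- Since p′ < m, regular steps add up to less than dm, and the required inequalities become
    -- inequalities between the coefficients of m.
    hypotheses :
      (∀ i → i < p → 12 * m + 8 * m * i < a i × a i ≤ 12 * m + 8 * m * suc i) →
      (∀ i → i < p → 12 * m + 8 * m * (p + i) < a′ i × a′ i ≤ 12 * m + 8 * m * suc (p + i)) →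
      (∀ i → i < p′ → a i ≡ y₁ i + d) → a p′ + 0 * m ≡ y₁ p′ + D₀ * m →
      (∀ i → i < p′ → a′ i ≡ y′ i + d) → a′ p′ + 3 * m ≡ y′ p′ + D₀ * m →
      Triple m (3 * m) (U₀ * m) x y z → Hypotheses
    hypotheses ra ra′ u j dn j′ t = record
      { 1≤d = 1≤d
      ; d*p′<D = ℕ.<-≤-trans d*p′<d*m (ℕ.*-monoˡ-≤ m d≤D₀)
      ; D+d*p′<U = D+d*p′< D₀+d≤U₀
      ; U≤6m = ℕ.*-monoˡ-≤ m U₀≤6
      ; R<U = ℕ.*-monoˡ-< m 3<U₀
      ; d*p′<R = ℕ.<-≤-trans d*p′<d*m (ℕ.*-monoˡ-≤ m d≤3)
      ; R∉D+ = Sum.map (ℕ.*-monoˡ-< m) D+d*p′< 3∉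
      ; a-range = ra
      ; a′-range = ra′
      ; up = u
      ; jump = trans (sym (ℕ.+-identityʳ _)) j
      ; down = dn
      ; jump′ = trans j′ (ℕ.+-comm (y′ p′) _)
      ; triple = t
      }

  cong-catMaybes₂ : ∀ {s t s′ t′ : Maybe ℤ} → s ≡ s′ → t ≡ t′ →
    catMaybes (s ∷ t ∷ []) ≡ catMaybes (s′ ∷ t′ ∷ [])
  cong-catMaybes₂ refl refl = refl

  Line-row : ∀ {K} → K < m → ∀ P ρ → Line v k (concat (applyUpTo (λ s → row s K P ρ) N))
  Line-row {K} K<m P ρ with x , y , z , t , e ← row-triple K<m P ρ =
    Line-blocks
      (hypotheses {1} {1} {5} (ℕ.m≤m+n _ _) (ℕ.m≤m+n _ _) (ℕ.m≤m+n _ _) (ℕ.m≤m+n _ _) (ℕ.m≤m+n _ _) (ℕ.m≤m+n _ _)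
        (inj₂ (ℕ.m≤m+n _ _))
        (λ i _ → magnitude-range false i K<m P ρ false)
        (λ i _ → magnitude-range true i K<m P ρ false)
        (λ i i<p′ → side-diff false i {K} {P} {ρ} {false} {P} {ρ} {true} i<p′ (bits-1 P (not ρ)))
        (corner-diff false {K} {P} {ρ} {false} {P} {ρ} {true} 0 1 (trans (ℕ.+-identityʳ _) (bits-1 (not ρ) P)))
        (λ i i<p′ → side-diff true i {K} {P} {ρ} {false} {P} {ρ} {true} i<p′ (bits-1 P (not ρ)))
        -- As δ is complemented here, `y′ p′` is the larger entry, by 2m; this is 3m against m.
        (corner-diff true {K} {P} {ρ} {false} {P} {ρ} {true} 3 1
          (trans (sym (ℕ.+-assoc _ 2 1)) (cong (λ c → c + 1) (sym (bits-2 P (not ρ))))))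
        t)
      (λ s → row s K P ρ) ρ e
      (λ i i<p → cong-catMaybes₂ (pairBlock-first i<p K P ρ false) (pairBlock-first i<p K P ρ true))
      (λ i i<p → cong-catMaybes₂ (pairBlock-second i<p K P ρ false) (pairBlock-second i<p K P ρ true))
      (λ i → cong-catMaybes₂ (pairBlock-none i K P ρ false) (pairBlock-none i K P ρ true))

  -- Down a column the block row, and with it `K s` and `P s`, changes from block to block. This is
  -- harmless: the two cells inside a block share both and differ only in the bit ε.
  Line-column : ∀ (K : ℕ → ℕ) (P : ℕ → Bool) → (∀ s → K s < m) → ∀ γ {x y z} →
    Triple m (3 * m) (6 * m) x y z →
    column 0 (K 0) (P 0) γ ++ column 1 (K 1) (P 1) γ ++ column 2 (K 2) (P 2) γ ≡ map (flip γ) (x ∷ y ∷ z ∷ []) →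
    Line v k (concat (applyUpTo (λ s → column s (K s) (P s) γ) N))
  Line-column K P K<m γ t e =
    Line-blocks
      (hypotheses {2} {4} {6} (ℕ.m≤m+n _ _) (ℕ.m≤m+n _ _) (ℕ.m≤m+n _ _) (ℕ.m≤m+n _ _) (ℕ.m≤m+n _ _) (ℕ.m≤m+n _ _)
        (inj₁ (ℕ.m≤m+n _ _))
        (λ i _ → magnitude-range false i (K<m (3 + i)) (P (3 + i)) false γ)
        (λ i _ → magnitude-range true i (K<m (3 + (p + i))) (P (3 + (p + i))) false γ)
        (λ i i<p′ → side-diff false i {_} {P (3 + i)} {false} {γ} {P (3 + i)} {true} {γ} i<p′ (bits-2 (P (3 + i)) (not γ)))
        (corner-diff false {_} {P (3 + p′)} {false} {γ} {P (3 + p′)} {true} {γ} 0 4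
          (trans (ℕ.+-identityʳ _) (bits-4 (P (3 + p′)) (not γ))))
        (λ i i<p′ → side-diff true i {_} {P (3 + (p + i))} {false} {γ} {P (3 + (p + i))} {true} {γ} i<p′ (bits-2 (P (3 + (p + i))) (not γ)))
        (corner-diff true {_} {P (3 + (p + p′))} {false} {γ} {P (3 + (p + p′))} {true} {γ} 3 4
          (trans (cong (λ c → c + 3) (bits-1 (P (3 + (p + p′))) (not (not γ)))) (ℕ.+-assoc _ 1 3)))
        t)
      (λ s → column s (K s) (P s) γ) γ e
      (λ i i<p → trans (cong-catMaybes₂ (pairBlock-first i<p (K (3 + i)) (P (3 + i)) false γ)
        (pairBlock-first i<p (K (3 + i)) (P (3 + i)) true γ)) (first γ))
      (λ i i<p → trans (cong-catMaybes₂ (pairBlock-second i<p (K (3 + (p + i))) (P (3 + (p + i))) false γ)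
        (pairBlock-second i<p (K (3 + (p + i))) (P (3 + (p + i))) true γ)) (second γ))
      (λ i → cong-catMaybes₂ (pairBlock-none i (K (3 + (p + (p + i)))) (P (3 + (p + (p + i)))) false γ)
        (pairBlock-none i (K (3 + (p + (p + i)))) (P (3 + (p + (p + i)))) true γ))
    where
    -- In an entry the sign of `ρ` is applied outside that of `γ`; to extract the sign common to the
    -- column they have to be interchanged.
    first : ∀ γ {s t} → flip false (flip γ (flip false (+ suc s))) ∷ flip true (flip γ (flip false (+ suc t))) ∷ [] ≡
      map (flip γ) (+ suc s ∷ - + suc t ∷ [])
    first false = refl
    first true  = refl
    second : ∀ γ {s t} → flip false (flip γ (flip true (+ suc s))) ∷ flip true (flip γ (flip true (+ suc t))) ∷ [] ≡
      map (flip γ) (- + suc s ∷ + suc t ∷ [])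
    second false = refl
    second true  = refl

  -- Inverting the cyclic shift of block indices

  %-absorb : ∀ x c → (x % N + c) % N ≡ (x + c) % N
  %-absorb x c = trans (sym ([m+kn]%n≡m%n (x % N + c) (x / N) N)) (cong (λ u → u % N)
    (trans (ℕ.+-assoc (x % N) c _) (trans (cong (λ u → x % N + u) (ℕ.+-comm c _))
      (trans (sym (ℕ.+-assoc (x % N) _ c)) (cong (λ u → u + c) (sym (m≡m%n+[m/n]*n x N)))))))

  unshift : ℕ → ℕ → ℕ
  unshift c s = (s + (N ∸ c % N)) % N

  private
    c+c̄ : ∀ c → c + (N ∸ c % N) ≡ suc (c / N) * N
    c+c̄ c = trans (cong (λ u → u + (N ∸ c % N)) (trans (m≡m%n+[m/n]*n c N) (ℕ.+-comm (c % N) _)))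
      (trans (ℕ.+-assoc (c / N * N) (c % N) _)
        (trans (cong (λ u → c / N * N + u) (ℕ.m+[n∸m]≡n (ℕ.<⇒≤ (m%n<n c N)))) (ℕ.+-comm _ N)))

  unshift< : ∀ c s → unshift c s < N
  unshift< c s = m%n<n _ N

  unshift-shift : ∀ c {x} → x < N → unshift c ((x + c) % N) ≡ x
  unshift-shift c {x} x<N = trans (%-absorb (x + c) _) (trans (cong (λ u → u % N)
    (trans (ℕ.+-assoc x c _) (cong (λ u → x + u) (c+c̄ c))))
    (trans ([m+kn]%n≡m%n x (suc (c / N)) N) (m<n⇒m%n≡m x<N)))

  shift-unshift : ∀ c {s} → s < N → (unshift c s + c) % N ≡ s
  shift-unshift c {s} s<N = trans (%-absorb (s + (N ∸ c % N)) c) (trans (cong (λ u → u % N)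
    (trans (ℕ.+-assoc s _ c) (cong (λ u → s + u) (trans (ℕ.+-comm _ c) (c+c̄ c)))))
    (trans ([m+kn]%n≡m%n s (suc (c / N)) N) (m<n⇒m%n≡m s<N)))

  -- Holds because `N` is even.
  odd-% : ∀ x → odd (x % N) ≡ odd x
  odd-% x = sym (trans (cong odd (trans (m≡m%n+[m/n]*n x N)
      (trans (ℕ.+-comm (x % N) _) (cong (λ u → u + x % N) (sym (ℕ.*-assoc (x / N) m 2))))))
    (trans (odd-+ (x / N * m * 2) (x % N)) (cong (λ b → b xor odd (x % N)) (odd-*2 (x / N * m)))))

  odd-unshift : ∀ c {s} → s < N → odd (unshift c s) ≡ odd s xor odd c
  odd-unshift c {s} s<N = xor-move (odd (unshift c s)) (odd c)
    (trans (sym (odd-+ (unshift c s) c)) (trans (sym (odd-% (unshift c s + c))) (cong odd (shift-unshift c s<N))))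
    where
    xor-move : ∀ x y {z} → x xor y ≡ z → x ≡ z xor y
    xor-move false false refl = refl
    xor-move false true  refl = refl
    xor-move true  false refl = refl
    xor-move true  true  refl = refl

  -- An even index below the even number `N` is not the last one, so its successor does not wrap
  -- around. This keeps the two filled 3-part blocks of a column in the same copy of the pattern.
  unshift-suc : ∀ c {s} → suc s < N → odd (unshift c s) ≡ false → unshift c (suc s) ≡ suc (unshift c s)
  unshift-suc c {s} s<N e = trans (cong (unshift c) (sym shift))
      (unshift-shift c (even-suc< m e (unshift< c s)))
    where
    shift : (suc (unshift c s) + c) % N ≡ suc s
    shift = trans (cong (λ u → u % N) (ℕ.+-comm 1 (unshift c s + c)))
      (trans (sym (%-absorb (unshift c s + c) 1)) (trans (cong (λ u → (u + 1) % N) (shift-unshift c (ℕ.<-trans (ℕ.n<1+n s) s<N)))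
        (trans (cong (λ u → u % N) (ℕ.+-comm s 1)) (m<n⇒m%n≡m s<N))))

  -- Rows and columns in natural order

  Line-rowEntries : ∀ i → Line v k (rowEntries array i)
  Line-rowEntries i = subst (Line v k) (sym (trans (catMaybes-pairs (cell (toℕ i)) N) (cong concat (applyUpTo-cong N entries))))
      (Line-cyclic (λ s → row s ⌊ I /2⌋ (odd I) (odd (toℕ i))) (I + 2) N (Line-row K<m (odd I) (odd (toℕ i))))
    where
    I = ⌊ toℕ i /2⌋
    K<m : ⌊ I /2⌋ < m
    K<m = ⌊/2⌋< m (⌊/2⌋< N (toℕ<n i))
    entries : ∀ J → J < N → catMaybes (cell (toℕ i) (J * 2) ∷ cell (toℕ i) (suc (J * 2)) ∷ []) ≡
      row ((J + (I + 2)) % N) ⌊ I /2⌋ (odd I) (odd (toℕ i))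
    entries J _ rewrite ⌊*2/2⌋ J | ⌊1+*2/2⌋ J | odd-*2 J | odd-1+*2 J = refl

  Line-colEntries : ∀ j → Line v k (colEntries array j)
  Line-colEntries j = subst (Line v k)
      (sym (trans (catMaybes-pairs (λ a → cell a (toℕ j)) N) (cong concat (applyUpTo-cong N entries))))
      (Line-cyclic (λ s → column s ⌊ ι s /2⌋ (odd (ι s)) γ) c N lines)
    where
    J = ⌊ toℕ j /2⌋
    c = J + 2
    γ = odd (toℕ j)
    ι = unshift c
    K<m : ∀ s → ⌊ ι s /2⌋ < m
    K<m s = ⌊/2⌋< m (unshift< c s)
    3≤N : 3 ≤ N
    3≤N = ℕ.≤-trans (ℕ.m≤m+n 3 _) 3+p+p≤N
    odd-ι : ∀ s → s < 3 → odd (ι s) ≡ odd s xor odd c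
    odd-ι s s<3 = odd-unshift c (ℕ.<-≤-trans s<3 3≤N)
    next : ∀ s → suc s < 3 → odd (ι s) ≡ false → ι (suc s) ≡ suc (ι s)
    next s s<2 = unshift-suc c (ℕ.<-≤-trans s<2 3≤N)
    lines : Line v k (concat (applyUpTo (λ s → column s ⌊ ι s /2⌋ (odd (ι s)) γ) N))
    -- The parity of `c` is that of the block column, the `Q` of the pattern. It decides whether the
    -- copy met begins at antidiagonal 0 or 1.
    lines with odd c | odd-ι 0 (s≤s z≤n) | odd-ι 1 (s≤s (s≤s z≤n)) | odd-ι 2 (s≤s (s≤s (s≤s z≤n)))
    ... | false | o₀ | o₁ | o₂ with x , y , z , t , e ← column-triple (K<m 0) false γ {⌊ ι 2 /2⌋} =
      Line-column (λ s → ⌊ ι s /2⌋) (λ s → odd (ι s)) K<m γ t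
        (trans (cong₂ _++_ (cong (λ P → column 0 ⌊ ι 0 /2⌋ P γ) o₀) (cong₂ _++_
          (cong₂ (λ K P → column 1 K P γ) (trans (cong ⌊_/2⌋ (next 0 (s≤s (s≤s z≤n)) o₀)) (proj₂ (even-suc (ι 0) o₀))) o₁)
          (cong (λ P → column 2 ⌊ ι 2 /2⌋ P γ) o₂))) e)
    ... | true  | o₀ | o₁ | o₂ with x , y , z , t , e ← column-triple (K<m 1) true γ {⌊ ι 0 /2⌋} =
      Line-column (λ s → ⌊ ι s /2⌋) (λ s → odd (ι s)) K<m γ t
        (trans (cong₂ _++_ (cong (λ P → column 0 ⌊ ι 0 /2⌋ P γ) o₀) (cong₂ _++_
          (cong (λ P → column 1 ⌊ ι 1 /2⌋ P γ) o₁)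
          (cong₂ (λ K P → column 2 K P γ) (trans (cong ⌊_/2⌋ (next 1 (s≤s (s≤s (s≤s z≤n))) o₁)) (proj₂ (even-suc (ι 1) o₁))) o₂))) e)
    swap : ∀ I → J + (I + 2) ≡ I + c
    swap I = trans (sym (ℕ.+-assoc J I 2)) (trans (cong (λ u → u + 2) (ℕ.+-comm J I)) (ℕ.+-assoc I J 2))
    entries : ∀ I → I < N → catMaybes (cell (I * 2) (toℕ j) ∷ cell (suc (I * 2)) (toℕ j) ∷ []) ≡
      column ((I + c) % N) ⌊ ι ((I + c) % N) /2⌋ (odd (ι ((I + c) % N))) γ
    entries I I<N rewrite ⌊*2/2⌋ I | ⌊1+*2/2⌋ I | odd-*2 I | odd-1+*2 I | swap I | unshift-shift c I<N = refl

-- Every absolute value occurs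

⌊bit+*2/2⌋ : ∀ b n → ⌊ bit b + n * 2 /2⌋ ≡ n
⌊bit+*2/2⌋ false n = ⌊*2/2⌋ n
⌊bit+*2/2⌋ true  n = ⌊1+*2/2⌋ n

odd-bit+*2 : ∀ b n → odd (bit b + n * 2) ≡ b
odd-bit+*2 false n = odd-*2 n
odd-bit+*2 true  n = odd-1+*2 n

bit+*2< : ∀ b {n k} → n < k → bit b + n * 2 < k * 2
bit+*2< false n<k = ℕ.*-monoˡ-< 2 n<k
bit+*2< true  n<k = ℕ.*-monoˡ-≤ 2 n<k

halves : ∀ w → w ≡ bit (odd w) + ⌊ w /2⌋ * 2
halves 0 = refl
halves 1 = refl
halves (suc (suc w)) = trans (cong (λ u → 2 + u) (halves w)) (eq (bit (odd w)) (⌊ w /2⌋ * 2))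
  where
  eq : ∀ b h → 2 + (b + h) ≡ b + (2 + h)
  eq = ℕS.solve-∀

bits-onto : ∀ {n} → n < 8 → ∃ λ x → ∃₂ λ y z → bits x y z ≡ n
bits-onto {0} _ = false , false , false , refl
bits-onto {1} _ = false , false , true  , refl
bits-onto {2} _ = false , true  , false , refl
bits-onto {3} _ = false , true  , true  , refl
bits-onto {4} _ = true  , false , false , refl
bits-onto {5} _ = true  , false , true  , refl
bits-onto {6} _ = true  , true  , false , refl
bits-onto {7} _ = true  , true  , true  , refl
bits-onto {suc (suc (suc (suc (suc (suc (suc (suc n)))))))} n<8 = ⊥-elim (ℕ.m+n≮m 8 n n<8)

module Coverage (m p′ : ℕ) (2+p≤m : 2 + suc p′ ≤ m) where

  open Construction m p′ 2+p≤m

  Occurs : ℕ → Set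
  Occurs x = ∃₂ λ i j → (array i j ≡ just (+ x)) ⊎ (array i j ≡ just (- (+ x)))

  -- The block row and the antidiagonal determine the block column, by `unshift`.
  locate : ∀ {s K} → s < N → K < m → ∀ P ρ γ → ∃₂ λ i j → array i j ≡ block s K P ρ γ
  locate {s} {K} s<N K<m P ρ γ = fromℕ< a< , fromℕ< b< , at
    where
    I = bit P + K * 2
    J = unshift (I + 2) s
    a< : bit ρ + I * 2 < N * 2
    a< = bit+*2< ρ (bit+*2< P K<m)
    b< : bit γ + J * 2 < N * 2
    b< = bit+*2< γ (unshift< (I + 2) s)
    at : cell (toℕ (fromℕ< a<)) (toℕ (fromℕ< b<)) ≡ block s K P ρ γ
    at rewrite toℕ-fromℕ< a< | toℕ-fromℕ< b< | ⌊bit+*2/2⌋ ρ I | ⌊bit+*2/2⌋ γ J | odd-bit+*2 ρ I | odd-bit+*2 γ J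
      | shift-unshift (I + 2) s<N | ⌊bit+*2/2⌋ P K | odd-bit+*2 P K = refl

  occurs : ∀ {s K x} → s < N → K < m → ∀ P ρ γ →
    (block s K P ρ γ ≡ just (+ x)) ⊎ (block s K P ρ γ ≡ just (- (+ x))) → Occurs x
  occurs s<N K<m P ρ γ e with i , j , at ← locate s<N K<m P ρ γ = i , j , Sum.map (trans at) (trans at) e

  s<N : ∀ {s} → s < 3 + (p + p) → s < N
  s<N s< = ℕ.<-≤-trans s< 3+p+p≤N

  formEntry-sign : ∀ K P ρ Q γ {σ f} → form P ρ Q γ ≡ just (σ , f) →
    (formEntry K P ρ Q γ ≡ just (+ ⟦ f ⟧ K (m ∸ suc K))) ⊎ (formEntry K P ρ Q γ ≡ just (- (+ ⟦ f ⟧ K (m ∸ suc K))))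
  formEntry-sign K P ρ Q γ {false} e rewrite e = inj₁ refl
  formEntry-sign K P ρ Q γ {true}  e rewrite e = inj₂ refl

  occurs-form : ∀ {K} → K < m → ∀ P ρ Q γ {σ f} → form P ρ Q γ ≡ just (σ , f) → Occurs (⟦ f ⟧ K (m ∸ suc K))
  occurs-form {K} K<m false ρ false γ e = occurs {0} (s<N (s≤s z≤n)) K<m false ρ γ (formEntry-sign K false ρ false γ e)
  occurs-form {K} K<m false ρ true  γ e = occurs {1} (s<N (s≤s (s≤s z≤n))) K<m false ρ γ (formEntry-sign K false ρ true γ e)
  occurs-form {K} K<m true  ρ false γ e = occurs {1} (s<N (s≤s (s≤s z≤n))) K<m true ρ γ (formEntry-sign K true ρ false γ e)
  occurs-form {K} K<m true  ρ true  γ e = occurs {2} (s<N (s≤s (s≤s (s≤s z≤n)))) K<m true ρ γ (formEntry-sign K true ρ true γ e)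

  opposite< : ∀ {r} → r < m → m ∸ suc r < m
  opposite< {r} r<m = subst (λ n → m ∸ suc r < n) (sym (K+r≡m r<m)) (s≤s (ℕ.m≤n+m _ r))

  opposite-opposite : ∀ {r} → r < m → m ∸ suc (m ∸ suc r) ≡ r
  opposite-opposite {r} r<m = ℕ.+-cancelˡ-≡ (suc (m ∸ suc r)) _ _
    (trans (sym (K+r≡m (opposite< r<m))) (trans (K+r≡m r<m) (cong suc (ℕ.+-comm r _))))

  occurs-K : ∀ {K} → K < m → ∀ {x} P ρ Q γ {σ f} → form P ρ Q γ ≡ just (σ , f) →
    (∀ r → m ≡ suc (K + r) → ⟦ f ⟧ K r ≡ x) → Occurs x
  occurs-K {K} K<m P ρ Q γ e h = subst Occurs (h _ (K+r≡m K<m)) (occurs-form K<m P ρ Q γ e)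

  -- Serves the forms whose values are enumerated by r; the copy in question is K = m - 1 - r.
  occurs-r : ∀ {r} → r < m → ∀ {x} P ρ Q γ {σ f} → form P ρ Q γ ≡ just (σ , f) →
    (∀ K → m ≡ suc (K + r) → ⟦ f ⟧ K r ≡ x) → Occurs x
  occurs-r {r} r<m P ρ Q γ {f = f} e h = subst Occurs
    (trans (cong (⟦ f ⟧ K) (opposite-opposite r<m)) (h K (trans (K+r≡m r<m) (cong suc (ℕ.+-comm r K)))))
    (occurs-form (opposite< r<m) P ρ Q γ e)
    where
    K = m ∸ suc r

  module _ (u : ℕ) where

    ascending-value : ∀ K r → m ≡ suc (K + r) → ⟦ ascending u ⟧ K r ≡ suc (u * m + K)
    ascending-value K r refl = eq u K r
      where
      eq : ∀ u K r → suc u + (suc u * K + u * r) ≡ suc (u * suc (K + r) + K)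
      eq = ℕS.solve-∀

    descending-value : ∀ r K → m ≡ suc (K + r) → ⟦ descending u ⟧ K r ≡ suc (u * m + r)
    descending-value r K refl = eq u K r
      where
      eq : ∀ u K r → suc u + (u * K + suc u * r) ≡ suc (u * suc (K + r) + r)
      eq = ℕS.solve-∀

    evens-value : ∀ K r → m ≡ suc (K + r) → ⟦ evens u ⟧ K r ≡ suc (u * m + suc (K * 2))
    evens-value K r refl = eq u K r
      where
      eq : ∀ u K r → 2 + u + ((2 + u) * K + u * r) ≡ suc (u * suc (K + r) + suc (K * 2))
      eq = ℕS.solve-∀

    odds-value : ∀ r K → m ≡ suc (K + r) → ⟦ odds u ⟧ K r ≡ suc (u * m + r * 2)
    odds-value r K refl = eq u K r
      where
      eq : ∀ u K r → suc u + (u * K + (2 + u) * r) ≡ suc (u * suc (K + r) + r * 2)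
      eq = ℕS.solve-∀

  -- The value lies w + 1 above 10m, so even w belong to `odds` and odd w to `evens`.
  occurs-10 : ∀ {w} → w < m * 2 → Occurs (suc (10 * m + w))
  occurs-10 {w} w< with ⌊ w /2⌋ | ⌊/2⌋< m w< | odd w | halves w
  ... | t | t<m | false | refl = occurs-r t<m false true true true refl (odds-value 10 t)
  ... | t | t<m | true  | refl = occurs-K t<m false false false false refl (evens-value 10 t)

  occurs-6 : ∀ {w} → w < m * 2 → Occurs (suc (6 * m + w))
  occurs-6 {w} w< with ⌊ w /2⌋ | ⌊/2⌋< m w< | odd w | halves w
  ... | t | t<m | false | refl = occurs-r t<m true true false true refl (odds-value 6 t)
  ... | t | t<m | true  | refl = occurs-K t<m true false true false refl (evens-value 6 t)

  w<2m : ∀ {w} → w < m → w < m * 2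
  w<2m w<m = ℕ.<-≤-trans w<m (ℕ.m≤m*n m 2)

  m+< : ∀ {w} → w < m → m + w < m * 2
  m+< {w} w<m = ℕ.<-≤-trans (ℕ.+-monoʳ-< m w<m) (ℕ.≤-reflexive (eq m))
    where
    eq : ∀ m → m + m ≡ m * 2
    eq = ℕS.solve-∀

  regroup : ∀ u w → suc (u * m + (m + w)) ≡ suc (suc u * m + w)
  regroup u w = cong suc (eq u m w)
    where
    eq : ∀ u m w → u * m + (m + w) ≡ suc u * m + w
    eq = ℕS.solve-∀

  occurs-3-part : ∀ u → u < 12 → ∀ {w} → w < m → Occurs (suc (u * m + w))
  occurs-3-part 0  _ {w} w<m = occurs-K w<m false true  true  false refl (ascending-value 0 w)
  occurs-3-part 1  _ {w} w<m = occurs-K w<m true  false true  true  refl (ascending-value 1 w)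
  occurs-3-part 2  _ {w} w<m = occurs-K w<m true  false false false refl (ascending-value 2 w)
  occurs-3-part 3  _ {w} w<m = occurs-K w<m false false true  false refl (ascending-value 3 w)
  occurs-3-part 4  _ {w} w<m = occurs-K w<m false false false true  refl (ascending-value 4 w)
  occurs-3-part 5  _ {w} w<m = occurs-K w<m true  true  false false refl (ascending-value 5 w)
  occurs-3-part 6  _     w<m = occurs-6 (w<2m w<m)
  -- The forms with u = 6 cover 2m values; this is the upper half, reached by adding m to `w`.
  occurs-3-part 7  _ {w} w<m = subst Occurs (regroup 6 w) (occurs-6 (m+< w<m))
  occurs-3-part 8  _ {w} w<m = occurs-r w<m false true  false true  refl (descending-value 8 w)
  occurs-3-part 9  _ {w} w<m = occurs-r w<m true  true  true  true  refl (descending-value 9 w)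
  occurs-3-part 10 _     w<m = occurs-10 (w<2m w<m)
  occurs-3-part 11 _ {w} w<m = subst Occurs (regroup 10 w) (occurs-10 (m+< w<m))
  occurs-3-part (suc (suc (suc (suc (suc (suc (suc (suc (suc (suc (suc (suc u)))))))))))) u<12 _ = ⊥-elim (ℕ.m+n≮m 12 u u<12)

  code-onto : ∀ h c {n} → n < 8 → ∃ λ P → ∃₂ λ ρ γ → code h c P (not ρ) (not γ) ≡ n
  code-onto h     false n<8 with x , y , z , e ← bits-onto n<8 =
    x , not y , not z , trans (cong₂ (bits x) (not-involutive y) (not-involutive z)) e
  code-onto false true  n<8 with x , y , z , e ← bits-onto n<8 =
    y , not x , not z , trans (cong₂ (λ ε δ → bits ε y δ) (not-involutive x) (not-involutive z)) e
  code-onto true  true  n<8 with x , y , z , e ← bits-onto n<8 =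
    x , not z , y , trans (cong₂ (bits x) (not-involutive y) (not-involutive z)) e

  -- Division with remainder in two bases: on the sides the code is the remainder modulo 8, at a
  -- corner `K` is the remainder modulo m.
  offset-onto : ∀ h c {w} → w < 8 * m → ∃ λ K → K < m × ∃ λ P → ∃₂ λ ρ γ → offset h c K P (not ρ) (not γ) ≡ w
  offset-onto h false {w} w< with P , ρ , γ , e ← code-onto h false (m%n<n w 8) =
    w / 8 , m<n*o⇒m/o<n (subst (λ n → w < n) (ℕ.*-comm 8 m) w<) , P , ρ , γ ,
    trans (cong (λ n → 8 * (w / 8) + n) e) (trans (ℕ.+-comm _ (w % 8))
      (trans (cong (λ n → w % 8 + n) (ℕ.*-comm 8 (w / 8))) (sym (m≡m%n+[m/n]*n w 8))))
  offset-onto h true {w} w< with P , ρ , γ , e ← code-onto h true (m<n*o⇒m/o<n w<) =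
    w % m , m%n<n w m , P , ρ , γ ,
    trans (cong (λ n → w % m + m * n) e) (trans (cong (λ n → w % m + n) (ℕ.*-comm m (w / m))) (sym (m≡m%n+[m/n]*n w m)))

  occurs-pair : ∀ h {i} → i < p → ∀ {w} → w < 8 * m → Occurs (suc (12 * m + 8 * m * index h i + w))
  occurs-pair h {i} i<p w< with K , K<m , P , ρ , γ , e ← offset-onto h (suc i ≡ᵇ p) w< =
    subst (λ w → Occurs (suc (12 * m + 8 * m * index h i + w))) e
      (occurs (s<N (ℕ.+-monoʳ-< 3 (index< h))) K<m P ρ γ (Sum.map (trans (at h)) (trans (at h)) (sign h ρ γ)))
    where
    index< : ∀ h → index h i < p + p
    index< false = ℕ.<-≤-trans i<p (ℕ.m≤m+n p p)
    index< true  = ℕ.+-monoʳ-< p i<p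
    at : ∀ h → pairBlock (index h i) K P ρ γ ≡ pairEntry h i K P ρ γ
    at false = pairBlock-first i<p K P ρ γ
    at true  = pairBlock-second i<p K P ρ γ
    sign : ∀ h ρ γ {n} → (just (flip ρ (flip γ (flip h (+ suc n)))) ≡ just (+ suc n)) ⊎
      (just (flip ρ (flip γ (flip h (+ suc n)))) ≡ just (- (+ suc n)))
    sign false false false = inj₁ refl
    sign false false true  = inj₂ refl
    sign false true  false = inj₂ refl
    sign false true  true  = inj₁ refl
    sign true  false false = inj₂ refl
    sign true  false true  = inj₁ refl
    sign true  true  false = inj₁ refl
    sign true  true  true  = inj₂ refl

  occurs-pairs : ∀ {u} → u < p + p → ∀ {w} → w < 8 * m → Occurs (suc (12 * m + 8 * m * u + w))
  occurs-pairs {u} u< {w} w< with u ℕ.<? p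
  ... | yes u<p = occurs-pair false u<p w<
  ... | no  u≮p = subst (λ u → Occurs (suc (12 * m + 8 * m * u + w))) u≡
      (occurs-pair true (ℕ.+-cancelˡ-< p _ _ (subst (λ n → n < p + p) (sym u≡) u<)) w<)
    where
    u≡ : p + (u ∸ p) ≡ u
    u≡ = ℕ.m+[n∸m]≡n (ℕ.≮⇒≥ u≮p)

  occurs-all : ∀ x → 1 ≤ x → x ≤ m * 2 * 2 * k → Occurs x
  occurs-all (suc q) _ q< with q ℕ.<? 12 * m
  ... | yes q<12m = subst (λ x → Occurs (suc x)) (sym (trans (m≡m%n+[m/n]*n q m) (ℕ.+-comm (q % m) _)))
        (occurs-3-part (q / m) (m<n*o⇒m/o<n q<12m) (m%n<n q m))
  ... | no q≮12m = subst (λ x → Occurs (suc x)) eq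
        (occurs-pairs (m<n*o⇒m/o<n t<) (m%n<n t (8 * m)))
    where
    instance
      8m≢0 : NonZero (8 * m)
      8m≢0 = ℕ.m*n≢0 8 m
    t = q ∸ 12 * m
    q≡ : 12 * m + t ≡ q
    q≡ = ℕ.m+[n∸m]≡n (ℕ.≮⇒≥ q≮12m)
    total : ∀ m p → m * 2 * 2 * (4 * p + 3) ≡ 12 * m + (p + p) * (8 * m)
    total = ℕS.solve-∀
    t< : t < (p + p) * (8 * m)
    t< = ℕ.+-cancelˡ-< (12 * m) _ _ (subst₂ _<_ (sym q≡) (total m p) q<)
    eq : 12 * m + 8 * m * (t / (8 * m)) + t % (8 * m) ≡ q
    eq = trans (ℕ.+-assoc (12 * m) _ _) (trans (cong (λ s → 12 * m + s)
      (trans (ℕ.+-comm _ (t % (8 * m))) (trans (cong (λ s → t % (8 * m) + s) (ℕ.*-comm (8 * m) _))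
        (sym (m≡m%n+[m/n]*n t (8 * m)))))) q≡)

  heffter : ∃ λ (A : Array (m * 2 * 2)) → IsHeffter (m * 2 * 2) k A × IsGloballySimple (m * 2 * 2) k A
  heffter = array ,
    ((λ i → Line⇒GoodLine (Line-rowEntries i)) , (λ j → Line⇒GoodLine (Line-colEntries j)) , occurs-all) ,
    (λ i → Line⇒SimpleLine (Line-rowEntries i)) , (λ j → Line⇒SimpleLine (Line-colEntries j))

theorem1p7 : Σ ℕ λ c → (1 ≤ c) × Σ ℕ λ n₀ →
    (n p : ℕ) → 1 ≤ n → n % 4 ≡ 0 → 1 ≤ p → n₀ ≤ n →
    c * (⌈log₂ n ⌉ ^ 2) + 4 * p ≤ n →
    ∃ λ (A : Array n) → IsHeffter n (4 * p + 3) A × IsGloballySimple n (4 * p + 3) A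
-- For n ≥ 2 the logarithm is at least 1, so c = 8 gives n - 4p ≥ 8, which is p + 2 ≤ m for n = 4m.
theorem1p7 = 8 , s≤s z≤n , 2 , λ where
  n (suc p′) _ n%4≡0 _ 2≤n h →
    let m = n / 4
        n≡4m : n ≡ m * 2 * 2
        n≡4m = trans (m≡m%n+[m/n]*n n 4) (trans (cong (λ r → r + m * 4) n%4≡0) (sym (ℕ.*-assoc m 2 2)))
        1≤log : 1 ≤ ⌈log₂ n ⌉
        1≤log = subst (λ l → l ≤ ⌈log₂ n ⌉) (⌈log₂2^n⌉≡n 1) (⌈log₂⌉-mono-≤ 2≤n)
        8+4p≤4m : 4 * (2 + suc p′) ≤ 4 * m
        8+4p≤4m = ℕ.≤-trans (ℕ.≤-reflexive (ℕ.*-distribˡ-+ 4 2 (suc p′)))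
          (ℕ.≤-trans (ℕ.+-monoˡ-≤ (4 * suc p′) (ℕ.*-monoʳ-≤ 8 (ℕ.^-monoˡ-≤ 2 1≤log)))
            (ℕ.≤-trans h (ℕ.≤-reflexive (trans n≡4m (trans (ℕ.*-assoc m 2 2) (ℕ.*-comm m 4))))))
    in subst (λ n → ∃ λ (A : Array n) → IsHeffter n (4 * suc p′ + 3) A × IsGloballySimple n (4 * suc p′ + 3) A)
         (sym n≡4m) (Coverage.heffter m p′ (ℕ.*-cancelˡ-≤ 4 8+4p≤4m))
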